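{- Let $H$ be a finite graph without multiple edges, possibly with loops, and with no isolated vertices. Let $G$ be an $n$-vertex $2$-regular finite simple graph. Then \[ \hom(G,H) \leq \max \{\hom(C_{3},H)^{\frac{n}{3}}, \hom(C_{4},H)^{\frac{n}{4}}\}. \] Moreover, if $H$ is not of the form $K_{q}^{\text{loop}}$ (for any $q \ge 1$), then the only graphs $G$ achieving equality are: $G = \frac{n}{3} C_3$ when $\hom(C_3,H)^{\frac{1}{3}} > \hom(C_4,H)^{\frac{1}{4}}$; $G = \frac{n}{4} C_4$ when $\hom(C_3,H)^{\frac{1}{3}} < \hom(C_4,H)^{\frac{1}{4}}$; and disjoint unions of copies of $C_3$ and copies of $C_4$ when $\hom(C_3,H)^{\frac{1}{3}} = \hom(C_4,H)^{\frac{1}{4}}$.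
   Context: For a finite simple (loopless) graph $G$ and a finite graph $H$ (no multiple edges, loops allowed), $\hom(G,H)$ is the number of maps $f:V(G)\to V(H)$ such that $v\sim_G w$ implies $f(v)\sim_H f(w)$. A vertex of $H$ is isolated if it is incident to no edge and no loop (a looped vertex is not isolated). $C_k$ is the cycle on $k$ vertices. $K_q^{\text{loop}}$ is the fully looped complete graph on $q$ vertices (all pairs of vertices adjacent, including each vertex to itself). $\frac{n}{k}F$, for a $k$-vertex graph $F$, is the disjoint union of $n/k$ copies of $F$ (it exists only when $k \mid n$). Graph equality is up to isomorphism. -}

module Defs where

open import Data.Empty using (⊥)
open import Data.Fin.Base using (Fin; toℕ; finToFun; splitAt)
open import Data.Fin.Properties using (all?)
open import Data.Nat.Base using (ℕ; zero; suc; _+_; _*_; _^_; _⊔_; _≤_; _<_; NonZero)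
open import Data.Nat.Divisibility using (_∣_; quotient)
open import Data.Nat.DivMod using (_%_)
open import Data.Nat.Properties using (_≟_; m*n≢0)
open import Data.Product.Base using (Σ-syntax; ∃-syntax)
open import Data.Sum.Base using (_⊎_; swap)
open import Data.Sum.Relation.Binary.Pointwise using (Pointwise; ⊎-symmetric; ⊎-decidable)
open import Data.Unit.Base using (⊤; tt)
open import Data.Vec.Base using (allFin; count)
open import Function.Base using (_on_)
open import Function.Bundles using (_↔_; _⇔_; module Inverse)
open import Level using (0ℓ)
open import Relation.Binary.Core using (Rel)
open import Relation.Binary.Definitions using (Decidable; Symmetric)
open import Relation.Binary.PropositionalEquality.Core using (_≡_)
open import Relation.Nullary.Decidable.Core using (Dec; yes; no; _→-dec_; _⊎-dec_)
open import Relation.Nullary.Negation.Core using (¬_)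

-- A finite graph without multiple edges.  A loop at v is a proof of v ~ v.
-- The vertex set may be empty.
record Graph : Set₁ where
  infix 4 _~_ _~?_
  field
    order : ℕ
    _~_   : Rel (Fin order) 0ℓ
    ~-sym : Symmetric _~_
    _~?_  : Decidable _~_

  Vertex : Set
  Vertex = Fin order

  -- For loopless graphs, the number of neighbours of v.
  degree : Vertex → ℕ
  degree v = count (v ~?_) (allFin order)

  Isolated : Vertex → Set
  Isolated v = ¬ (∃[ w ] v ~ w)

open Graph using (order; degree; Isolated)

Simple : Graph → Set
Simple G = ∀ v → ¬ (v ~ v)
  where open Graph G using (_~_)

Regular : ℕ → Graph → Set
Regular d G = ∀ v → degree G v ≡ d

NoIsolatedVertices : Graph → Set
NoIsolatedVertices G = ∀ v → ¬ Isolated G v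

infix 4 _≅_

record _≅_ (G H : Graph) : Set where
  private
    module G = Graph G
    module H = Graph H
  field
    bijection : G.Vertex ↔ H.Vertex
  open Inverse bijection using (to)
  field
    preserves : ∀ v w → (v G.~ w) ⇔ (to v H.~ to w)

module _ (G H : Graph) where
  private
    module G = Graph G
    module H = Graph H

  IsHom : (G.Vertex → H.Vertex) → Set
  IsHom f = ∀ v w → v G.~ w → f v H.~ f w

  isHom? : ∀ f → Dec (IsHom f)
  isHom? f = all? λ v → all? λ w → (v G.~? w) →-dec (f v H.~? f w)

  -- The maps V(G) → V(H) are enumerated, each exactly once, by finToFun
  -- on Fin (∣V(H)∣ ^ ∣V(G)∣).
  hom : ℕ
  hom = count (λ k → isHom? (finToFun k)) (allFin (H.order ^ G.order))

-- A cycle in the graph-theoretic sense only for k ≥ 3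
-- (k = 1 gives a loop, k = 2 a single edge).
C : ∀ k → .{{NonZero k}} → Graph
C k = record
  { order = k
  ; _~_   = λ u v → Next u v ⊎ Next v u
  ; ~-sym = swap
  ; _~?_  = λ u v → next? u v ⊎-dec next? v u
  }
  where
  Next : Rel (Fin k) 0ℓ
  Next u v = toℕ v ≡ suc (toℕ u) % k

  next? : Decidable Next
  next? u v = toℕ v ≟ suc (toℕ u) % k

K-loop : ℕ → Graph
K-loop q = record
  { order = q
  ; _~_   = λ _ _ → ⊤
  ; ~-sym = λ _ → tt
  ; _~?_  = λ _ _ → yes tt
  }

∅ᴳ : Graph
∅ᴳ = record
  { order = 0
  ; _~_   = λ _ _ → ⊥
  ; ~-sym = λ ()
  ; _~?_  = λ _ _ → no λ ()
  }

infixr 6 _⊎ᴳ_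
infix  7 _copiesOf_

_⊎ᴳ_ : Graph → Graph → Graph
G ⊎ᴳ H = record
  { order = G.order + H.order
  ; _~_   = Pointwise G._~_ H._~_ on splitAt G.order
  ; ~-sym = ⊎-symmetric G.~-sym H.~-sym
  ; _~?_  = λ u v → ⊎-decidable G._~?_ H._~?_ (splitAt G.order u) (splitAt G.order v)
  }
  where
  module G = Graph G
  module H = Graph H

_copiesOf_ : ℕ → Graph → Graph
zero  copiesOf F = ∅ᴳ
suc k copiesOf F = F ⊎ᴳ k copiesOf F

-- G = (n/k) F with n = ∣V(G)∣ and k = ∣V(F)∣; this includes k ∣ n.
IsCopiesOf : Graph → Graph → Set
IsCopiesOf F G = Σ[ k∣n ∈ order F ∣ order G ] G ≅ quotient k∣n copiesOf F

IsDisjointUnionOf : Graph → Graph → Graph → Set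
IsDisjointUnionOf E F G = ∃[ a ] ∃[ b ] G ≅ a copiesOf E ⊎ᴳ b copiesOf F

-- a ^⟨ p / q ⟩ denotes the real number a^(p/q) ≥ 0, with the convention
-- 0^0 = 1.  Different expressions may denote the same real number, so they
-- are compared with _≈ᵖ_ rather than _≡_.
infix 8 _^⟨_/_⟩

record Power : Set where
  constructor _^⟨_/_⟩
  field
    base              : ℕ
    numerator         : ℕ
    denominator       : ℕ
    .{{denominator≢0}} : NonZero denominator

fromℕ : ℕ → Power
fromℕ a = a ^⟨ 1 / 1 ⟩

infix 4 _≤ᵖ_ _<ᵖ_ _≈ᵖ_

-- The comparisons of a^(p/q) with b^(r/s) are obtained by raising both
-- sides to the power q s, which is strictly monotone on reals ≥ 0.
_≤ᵖ_ _<ᵖ_ _≈ᵖ_ : Rel Power 0ℓ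
(a ^⟨ p / q ⟩) ≤ᵖ (b ^⟨ r / s ⟩) = a ^ (p * s) ≤ b ^ (r * q)
(a ^⟨ p / q ⟩) <ᵖ (b ^⟨ r / s ⟩) = a ^ (p * s) < b ^ (r * q)
(a ^⟨ p / q ⟩) ≈ᵖ (b ^⟨ r / s ⟩) = a ^ (p * s) ≡ b ^ (r * q)

-- max {a^(p/q), b^(r/s)} = max {a^(p s), b^(r q)} ^ (1/(q s)).
max : Power → Power → Power
max (a ^⟨ p / q ⟩) (b ^⟨ r / s ⟩) =
  _^⟨_/_⟩ (a ^ (p * s) ⊔ b ^ (r * q)) 1 (q * s) {{m*n≢0 q s}}

{-# OPTIONS --safe #-}

-- Write A for the adjacency matrix of H, so that hom(C k, H) is the trace of
-- A^k.  A 2-regular simple graph is a disjoint union of cycles of length at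
-- least 3 and hom is multiplicative over disjoint unions, so everything reduces
-- to comparing traces of powers.  Cauchy–Schwarz and the submultiplicativity of
-- the Frobenius norm, both inequalities between natural numbers, give
-- (tr A^k)^4 ≤ (tr A^4)^k for k ≥ 4.  For k ≥ 5 equality forces
-- tr A^8 = (tr A^4)^2, so the rows of A^2 are pairwise proportional; without
-- isolated vertices all vertices of H then have the same neighbourhood, and H
-- is a fully looped complete graph.
module Submission where

open import Defs
open import Data.Bool.Base using (if_then_else_; true; false)
open import Data.Fin.Base
  using (Fin; zero; suc; _↑ˡ_; _↑ʳ_; combine; quotient; remainder; finToFun; funToFin; splitAt;
         inject₁; toℕ; fromℕ<; punchIn; punchOut) renaming (fromℕ to top)
open import Data.Fin.Permutation
  using (Permutation; _⟨$⟩ʳ_; _⟨$⟩ˡ_; permutation; inverseˡ; inverseʳ; insert; insert-punchIn; ↔⇒≡)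
import Data.Fin.Permutation as Perm
open import Data.Fin.Properties
  using (_≟_; any?; pigeonhole; finToFun-funToFin; funToFin-finToFin; remQuot-combine; splitAt-↑ˡ;
         splitAt-↑ʳ; splitAt⁻¹-↑ˡ; splitAt⁻¹-↑ʳ; +↔⊎; toℕ-injective; toℕ-inject₁; toℕ-fromℕ;
         toℕ-fromℕ<; toℕ<n; suc-injective; punchOut-injective; punchIn-punchOut)
open import Data.Fin.Relation.Unary.Top using (view; ‵fromℕ; ‵inject₁)
open import Data.List.Base using (List; []; _∷_)
open import Data.List.Relation.Unary.All using (All; []; _∷_)
import Data.List.Relation.Unary.All as All
open import Data.Nat.Base hiding (_/_)
open import Data.Nat.Divisibility using (divides) renaming (quotient to quotientℕ)
open import Data.Nat.DivMod using (_%_; n%n≡0; m<n⇒m%n≡m)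
open import Data.Nat.Properties hiding (_≟_; suc-injective)
import Data.Nat.Properties as ℕ
import Algebra.Properties.Semiring.Sum +-*-semiring as Sum
open import Data.Nat.Solver using (module +-*-Solver)
open import Data.Product.Base using (_×_; _,_; proj₁; proj₂; uncurry; ∃-syntax; Σ-syntax)
open import Data.Sum.Algebra using (⊎-assoc; ⊎-comm)
open import Data.Sum.Base using (_⊎_; inj₁; inj₂; [_,_]′)
open import Data.Sum.Function.Propositional using (_⊎-↔_)
open import Data.Sum.Relation.Binary.Pointwise using (Pointwise; inj₁; inj₂)
open import Data.Unit.Base using (tt)
open import Data.Vec.Base using (count; tabulate)
open import Data.Vec.Functional using (_++_) renaming (_∷_ to _∷ᶠ_)
open import Function.Base using (_∘_; id)
open import Function.Bundles using (Equivalence; Inverse; mk⇔; _⇔_; _↔_)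
open import Function.Construct.Composition using (_⇔-∘_; _↔-∘_)
open import Function.Construct.Identity using (⇔-id; ↔-id)
open import Function.Construct.Symmetry using (⇔-sym; ↔-sym)
open import Function.Definitions using (Injective)
open import Level using (0ℓ)
open import Relation.Binary.Core using (Rel)
open import Relation.Binary.Definitions using (tri<; tri≈; tri>)
open import Relation.Binary.PropositionalEquality
open import Relation.Nullary.Decidable.Core using (Dec; yes; no; does; _×-dec_; decidable-stable)
open import Relation.Nullary.Negation.Core using (¬_; contradiction)
open import Relation.Unary using (Decidable)

-- All estimates stay in the natural numbers. Since 12 clears the denominators 3 and 4, the target
-- for a graph F on n vertices becomes hom(F, H)^12 ≤ M^n with M = max(hom(C 3, H)^4, hom(C 4,
-- H)^3). Both sides are multiplicative over disjoint unions, so single cycles suffice, and if M >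
-- 0, equality for a union forces equality for each component.
--
-- For k ≥ 4, tr A^k is the Frobenius inner product of A^2 and A^(k-2), which leaves ‖A^(k-2)‖^4 ≤
-- (tr A^4)^(k-2) to show. Splitting off A^2 lowers the exponent by two at a time, so each parity
-- needs its own start. The even one, A^2, is trivial. The odd one, A^3, comes by interpolation:
-- ‖A^3‖^2 = tr A^6 is the inner product of A^2 and A^4, and ‖A^4‖^2 = tr A^8 ≤ (tr A^4)^2. Hence
-- the single strict inequality tr A^8 < (tr A^4)^2 makes the starts A^3 and A^4 strict, and with
-- them every k ≥ 5.

open Graph using (order)
open Equivalence using (to; from)

-- Finite sums

-- Opaque, so that unification sees ∑ as a rigid head instead of unfolding it.
opaque
  ∑ : ∀ {n} → (Fin n → ℕ) → ℕ
  ∑ = Sum.sum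

  ∑-zero : (f : Fin 0 → ℕ) → ∑ f ≡ 0
  ∑-zero f = refl

  ∑-suc : ∀ {n} (f : Fin (suc n) → ℕ) → ∑ f ≡ f zero + ∑ (λ i → f (suc i))
  ∑-suc f = refl

  ∑-cong : ∀ {n} {f g : Fin n → ℕ} → (∀ i → f i ≡ g i) → ∑ f ≡ ∑ g
  ∑-cong = Sum.sum-cong-≗

  ∑-comm : ∀ {m n} (f : Fin m → Fin n → ℕ) → (∑ λ i → ∑ λ j → f i j) ≡ (∑ λ j → ∑ λ i → f i j)
  ∑-comm = Sum.∑-comm

  ∑-distrib-+ : ∀ {n} (f g : Fin n → ℕ) → (∑ λ i → f i + g i) ≡ ∑ f + ∑ g
  ∑-distrib-+ = Sum.∑-distrib-+

  ∑-permute : ∀ {m n} (f : Fin n → ℕ) (π : Permutation m n) → ∑ f ≡ ∑ λ i → f (π ⟨$⟩ʳ i)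
  ∑-permute = Sum.∑-permute

  *-distribˡ-∑ : ∀ {n} x (f : Fin n → ℕ) → x * ∑ f ≡ ∑ λ i → x * f i
  *-distribˡ-∑ = Sum.*-distribˡ-sum

  *-distribʳ-∑ : ∀ {n} x (f : Fin n → ℕ) → ∑ f * x ≡ ∑ λ i → f i * x
  *-distribʳ-∑ = Sum.*-distribʳ-sum

  ∑-mono : ∀ {n} {f g : Fin n → ℕ} → (∀ i → f i ≤ g i) → ∑ f ≤ ∑ g
  ∑-mono {zero}  f≤g = z≤n
  ∑-mono {suc n} f≤g = +-mono-≤ (f≤g zero) (∑-mono λ i → f≤g (suc i))

  ∑-+ : ∀ m {n} (f : Fin (m + n) → ℕ) → ∑ f ≡ (∑ λ i → f (i ↑ˡ n)) + (∑ λ j → f (m ↑ʳ j))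
  ∑-+ zero    f = refl
  ∑-+ (suc m) f = trans (cong (f zero +_) (∑-+ m λ k → f (suc k))) (sym (+-assoc (f zero) _ _))

  ∑-* : ∀ m {n} (f : Fin (m * n) → ℕ) → ∑ f ≡ ∑ λ i → ∑ λ j → f (combine {m} {n} i j)
  ∑-* zero    f = refl
  ∑-* (suc m) {n} f = trans (∑-+ n f) (cong ((∑ λ j → f (j ↑ˡ (m * n))) +_) (∑-* m λ k → f (n ↑ʳ k)))

+-tight : ∀ {a b c d} → a ≤ b → c ≤ d → a + c ≡ b + d → a ≡ b × c ≡ d
+-tight {a} {b} {c} {d} a≤b c≤d eq = a≡b , +-cancelˡ-≡ b c d (subst (λ x → x + c ≡ b + d) a≡b eq)
  where
  a≡b : a ≡ b
  a≡b = ≤-antisym a≤b (+-cancelʳ-≤ d b a (≤-trans (≤-reflexive (sym eq)) (+-monoʳ-≤ a c≤d)))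

opaque
  unfolding ∑

  ∑-tight : ∀ {n} {f g : Fin n → ℕ} → (∀ i → f i ≤ g i) → ∑ f ≡ ∑ g → ∀ i → f i ≡ g i
  ∑-tight {suc n} f≤g eq zero    = proj₁ (+-tight (f≤g zero) (∑-mono λ j → f≤g (suc j)) eq)
  ∑-tight {suc n} f≤g eq (suc i) =
    ∑-tight (λ j → f≤g (suc j)) (proj₂ (+-tight (f≤g zero) (∑-mono λ j → f≤g (suc j)) eq)) i

∑-cong₂ : ∀ {m n} {f g : Fin m → Fin n → ℕ} → (∀ i j → f i j ≡ g i j) →
          (∑ λ i → ∑ (f i)) ≡ (∑ λ i → ∑ (g i))
∑-cong₂ f≡g = ∑-cong λ i → ∑-cong (f≡g i)

∑-distrib-+₂ : ∀ {m n} (f g : Fin m → Fin n → ℕ) →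
  (∑ λ i → ∑ λ j → f i j + g i j) ≡ (∑ λ i → ∑ (f i)) + (∑ λ i → ∑ (g i))
∑-distrib-+₂ f g = trans (∑-cong λ i → ∑-distrib-+ (f i) (g i)) (∑-distrib-+ _ _)

∑-*-∑ : ∀ {m n} (f : Fin m → ℕ) (g : Fin n → ℕ) → ∑ f * ∑ g ≡ ∑ λ i → ∑ λ j → f i * g j
∑-*-∑ f g = trans (*-distribʳ-∑ _ f) (∑-cong λ i → *-distribˡ-∑ (f i) g)

-- Cauchy-Schwarz over the natural numbers, with its equality case

am-gm-gap : ∀ a d → a * a + (a + d) * (a + d) ≡ a * (a + d) + a * (a + d) + d * d
am-gm-gap = solve 2 (λ a d → a :* a :+ (a :+ d) :* (a :+ d) := a :* (a :+ d) :+ a :* (a :+ d) :+ d :* d) refl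
  where open +-*-Solver

-- Writing `b = a + d` avoids subtraction: the gap is `d * d`, and equality forces `d = 0`.
am-gm-≤ : ∀ {a b} → a ≤ b → a * b + a * b ≤ a * a + b * b × (a * b + a * b ≡ a * a + b * b → a ≡ b)
am-gm-≤ {a} {b} a≤b with m≤n⇒∃[o]m+o≡n a≤b
... | d , refl rewrite am-gm-gap a d = m≤m+n _ (d * d) , tight
  where
  tight : a * (a + d) + a * (a + d) ≡ a * (a + d) + a * (a + d) + d * d → a ≡ a + d
  tight eq with m*n≡0⇒m≡0∨n≡0 d (sym (+-cancelˡ-≡ _ 0 (d * d) (trans (+-identityʳ _) eq)))
  ... | inj₁ refl = sym (+-identityʳ a)
  ... | inj₂ refl = sym (+-identityʳ a)

am-gm : ∀ a b → a * b + a * b ≤ a * a + b * b × (a * b + a * b ≡ a * a + b * b → a ≡ b)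
am-gm a b with ≤-total a b
... | inj₁ a≤b = am-gm-≤ a≤b
... | inj₂ b≤a rewrite *-comm a b | +-comm (a * a) (b * b) =
  proj₁ (am-gm-≤ b≤a) , λ eq → sym (proj₂ (am-gm-≤ b≤a) eq)

module CauchySchwarz {n} (x y : Fin n → ℕ) where

  private
    ⟨x,y⟩ = (∑ λ i → x i * y i)
    ∥x∥²  = (∑ λ i → x i * x i)
    ∥y∥²  = (∑ λ i → y i * y i)

    a : Fin n → Fin n → ℕ
    a i j = x i * y j

    swap₄ : ∀ p q r s → (p * q) * (r * s) ≡ (p * s) * (r * q)
    swap₄ = solve 4 (λ p q r s → (p :* q) :* (r :* s) := (p :* s) :* (r :* q)) refl
      where open +-*-Solver

    lhs : ⟨x,y⟩ * ⟨x,y⟩ ≡ (∑ λ i → ∑ λ j → a i j * a j i)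
    lhs = trans (∑-*-∑ _ _) (∑-cong₂ λ i j → swap₄ (x i) (y i) (x j) (y j))

    rhs : ∥x∥² * ∥y∥² ≡ (∑ λ i → ∑ λ j → a i j * a i j)
    rhs = trans (∑-*-∑ _ _) (∑-cong₂ λ i j → [m*n]*[o*p]≡[m*o]*[n*p] (x i) (x i) (y j) (y j))

    lhs₂ : ⟨x,y⟩ * ⟨x,y⟩ + ⟨x,y⟩ * ⟨x,y⟩ ≡ (∑ λ i → ∑ λ j → a i j * a j i + a i j * a j i)
    lhs₂ = trans (cong₂ _+_ lhs lhs) (sym (∑-distrib-+₂ (λ i j → _) (λ i j → _)))

    rhs₂ : ∥x∥² * ∥y∥² + ∥x∥² * ∥y∥² ≡ (∑ λ i → ∑ λ j → a i j * a i j + a j i * a j i)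
    rhs₂ = trans (cong₂ _+_ rhs (trans rhs (∑-comm _))) (sym (∑-distrib-+₂ (λ i j → _) (λ i j → _)))

    termwise : ∀ i j → a i j * a j i + a i j * a j i ≤ a i j * a i j + a j i * a j i
    termwise i j = proj₁ (am-gm (a i j) (a j i))

  -- Lagrange's identity: twice the deficit is the sum over `i` and `j` of (a i j - a j i)^2.
  -- Without subtraction, each square becomes one AM-GM inequality between `a i j` and `a j i`; in
  -- the equality case all of these are tight.
  inequality : ⟨x,y⟩ * ⟨x,y⟩ ≤ ∥x∥² * ∥y∥²
  inequality = *-cancelˡ-≤ 2 (begin
    2 * (⟨x,y⟩ * ⟨x,y⟩)             ≡⟨ cong (⟨x,y⟩ * ⟨x,y⟩ +_) (+-identityʳ _) ⟩
    ⟨x,y⟩ * ⟨x,y⟩ + ⟨x,y⟩ * ⟨x,y⟩   ≡⟨ lhs₂ ⟩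
    _                               ≤⟨ ∑-mono (λ i → ∑-mono (termwise i)) ⟩
    _                               ≡⟨ rhs₂ ⟨
    ∥x∥² * ∥y∥² + ∥x∥² * ∥y∥²       ≡⟨ cong (∥x∥² * ∥y∥² +_) (+-identityʳ _) ⟨
    2 * (∥x∥² * ∥y∥²)               ∎)
    where open ≤-Reasoning

  equality : ⟨x,y⟩ * ⟨x,y⟩ ≡ ∥x∥² * ∥y∥² → ∀ i j → x i * y j ≡ x j * y i
  equality eq i j = proj₂ (am-gm (a i j) (a j i))
    (∑-tight (termwise i) (∑-tight (λ i → ∑-mono (termwise i))
      (trans (sym lhs₂) (trans (cong₂ _+_ eq eq) rhs₂)) i) j)

-- Counting homomorphisms

⟦_⟧ : {P : Set} → Dec P → ℕ
⟦ P? ⟧ = if does P? then 1 else 0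

⟦⟧-cong : {P Q : Set} (P? : Dec P) (Q? : Dec Q) → P ⇔ Q → ⟦ P? ⟧ ≡ ⟦ Q? ⟧
⟦⟧-cong (yes p) (yes q) P⇔Q = refl
⟦⟧-cong (yes p) (no ¬q) P⇔Q = contradiction (to P⇔Q p) ¬q
⟦⟧-cong (no ¬p) (yes q) P⇔Q = contradiction (from P⇔Q q) ¬p
⟦⟧-cong (no ¬p) (no ¬q) P⇔Q = refl

⟦⟧-× : {P Q : Set} (P? : Dec P) (Q? : Dec Q) → ⟦ P? ×-dec Q? ⟧ ≡ ⟦ P? ⟧ * ⟦ Q? ⟧
⟦⟧-× P? Q? with does P?
... | true  = sym (+-identityʳ _)
... | false = refl

count-tabulate : ∀ {n} {A : Set} {P : A → Set} (P? : Decidable P) (f : Fin n → A) →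
                 count P? (tabulate f) ≡ ∑ λ i → ⟦ P? (f i) ⟧
count-tabulate {zero}  P? f = sym (∑-zero _)
count-tabulate {suc n} P? f = trans step (sym (∑-suc _))
  where
  step : count P? (tabulate f) ≡ ⟦ P? (f zero) ⟧ + ∑ (λ i → ⟦ P? (f (suc i)) ⟧)
  step with does (P? (f zero))
  ... | true  = cong suc (count-tabulate P? (f ∘ suc))
  ... | false = count-tabulate P? (f ∘ suc)

-- Sums over all maps between finite sets

∑ᶠ : ∀ n {q} → ((Fin n → Fin q) → ℕ) → ℕ
∑ᶠ n {q} F = ∑ λ (k : Fin (q ^ n)) → F (finToFun k)

-- Decoding a rearranged index yields a map that agrees with the expected one only pointwise, so
-- every summand has to respect pointwise equality.
Extensional : ∀ {n q} → ((Fin n → Fin q) → ℕ) → Set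
Extensional F = ∀ {f g} → f ≗ g → F f ≡ F g

∷-cong : ∀ {n} {A : Set} {x : A} {f g : Fin n → A} → f ≗ g → (x ∷ᶠ f) ≗ (x ∷ᶠ g)
∷-cong f≗g zero    = refl
∷-cong f≗g (suc i) = f≗g i

++-cong : ∀ {m n} {A : Set} {f f′ : Fin m → A} {g g′ : Fin n → A} → f ≗ f′ → g ≗ g′ → (f ++ g) ≗ (f′ ++ g′)
++-cong {m} f≗f′ g≗g′ k with splitAt m k
... | inj₁ i = f≗f′ i
... | inj₂ j = g≗g′ j

∷-++ : ∀ {m n} {A : Set} (x : A) (f : Fin m → A) (g : Fin n → A) → ((x ∷ᶠ f) ++ g) ≗ (x ∷ᶠ (f ++ g))
∷-++ x f g zero = refl
∷-++ {m} x f g (suc k) with splitAt m k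
... | inj₁ i = refl
... | inj₂ j = refl

∑ᶠ-zero : ∀ {q} {F : (Fin 0 → Fin q) → ℕ} → Extensional F → (f : Fin 0 → Fin q) → ∑ᶠ 0 F ≡ F f
∑ᶠ-zero {F = F} F-ext f =
  trans (∑-suc _) (trans (cong (F (finToFun {n = 0} zero) +_) (∑-zero _)) (trans (+-identityʳ _) (F-ext λ ())))

∑ᶠ-suc : ∀ {n q} {F : (Fin (suc n) → Fin q) → ℕ} → Extensional F →
         ∑ᶠ (suc n) F ≡ ∑ λ x → ∑ᶠ n λ f → F (x ∷ᶠ f)
∑ᶠ-suc {n} {q} F-ext = trans (∑-* q _) (∑-cong₂ λ x k → F-ext (finToFun-combine x k))
  where
  finToFun-combine : ∀ x k → finToFun {q} {suc n} (combine x k) ≗ (x ∷ᶠ finToFun k)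
  finToFun-combine x k zero    = cong proj₁ (remQuot-combine x k)
  finToFun-combine x k (suc i) = cong (λ ij → finToFun (proj₂ ij) i) (remQuot-combine x k)

∑ᶠ-++ : ∀ m {n q} {F : (Fin (m + n) → Fin q) → ℕ} → Extensional F →
        ∑ᶠ (m + n) F ≡ ∑ᶠ m λ f → ∑ᶠ n λ g → F (f ++ g)
∑ᶠ-++ zero {n} {q} {F} F-ext =
  sym (∑ᶠ-zero {F = λ f → ∑ᶠ n λ g → F (f ++ g)} (λ f≗g → refl) λ ())
∑ᶠ-++ (suc m) {n} {q} {F} F-ext = begin
  ∑ᶠ (suc m + n) F                                        ≡⟨ ∑ᶠ-suc F-ext ⟩
  (∑ λ x → ∑ᶠ (m + n) λ h → F (x ∷ᶠ h))
    ≡⟨ (∑-cong λ x → ∑ᶠ-++ m λ f≗g → F-ext (∷-cong f≗g)) ⟩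
  (∑ λ x → ∑ᶠ m λ f → ∑ᶠ n λ g → F (x ∷ᶠ (f ++ g)))
    ≡⟨ (∑-cong₂ λ x i → ∑-cong λ j → F-ext (λ k → sym (∷-++ x (finToFun {n = m} i) (finToFun {n = n} j) k))) ⟩
  (∑ λ x → ∑ᶠ m λ f → ∑ᶠ n λ g → F ((x ∷ᶠ f) ++ g))
    ≡⟨ (∑ᶠ-suc λ f≗g → ∑-cong λ k → F-ext (++-cong f≗g λ _ → refl)) ⟨
  (∑ᶠ (suc m) λ f → ∑ᶠ n λ g → F (f ++ g))                 ∎
  where open ≡-Reasoning

funToFin-cong : ∀ {m n} {f g : Fin m → Fin n} → f ≗ g → funToFin f ≡ funToFin g
funToFin-cong {zero}  f≗g = refl
funToFin-cong {suc m} f≗g = cong₂ combine (f≗g zero) (funToFin-cong (f≗g ∘ suc))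

precompose : ∀ {m n} q → Permutation m n → Permutation (q ^ m) (q ^ n)
precompose {m} {n} q π = permutation
  (λ k → funToFin (finToFun {q} {m} k ∘ (π ⟨$⟩ˡ_))) (λ k → funToFin (finToFun {q} {n} k ∘ (π ⟨$⟩ʳ_)))
  (λ k → trans (funToFin-cong {n} λ i → trans (finToFun-funToFin (finToFun k ∘ (π ⟨$⟩ʳ_)) _)
                                              (cong (finToFun k) (inverseʳ π)))
               (funToFin-finToFin {n} {q} k))
  (λ k → trans (funToFin-cong {m} λ i → trans (finToFun-funToFin (finToFun k ∘ (π ⟨$⟩ˡ_)) _)
                                              (cong (finToFun k) (inverseˡ π)))
               (funToFin-finToFin {m} {q} k))

∑ᶠ-permute : ∀ {m n q} {F : (Fin n → Fin q) → ℕ} → Extensional F → (π : Permutation m n) →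
             ∑ᶠ n F ≡ ∑ᶠ m λ f → F (f ∘ (π ⟨$⟩ˡ_))
∑ᶠ-permute {q = q} F-ext π =
  trans (∑-permute _ (precompose q π)) (∑-cong λ k → F-ext (finToFun-funToFin (finToFun k ∘ (π ⟨$⟩ˡ_))))

next-inject₁ : ∀ {m} (i : Fin m) → toℕ (suc i) ≡ suc (toℕ (inject₁ i)) % suc m
next-inject₁ {m} i rewrite toℕ-inject₁ i = sym (m<n⇒m%n≡m (s≤s (toℕ<n i)))

next-top : ∀ m → toℕ (zero {m}) ≡ suc (toℕ (top m)) % suc m
next-top m rewrite toℕ-fromℕ m = sym (n%n≡0 (suc m))

-- Eliminates the remainder operation: a cyclic successor is either an ordinary step or the single
-- wraparound from the last vertex to the first. Cycle arguments below split into these two cases.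
next-cases : ∀ {m} {u v : Fin (suc m)} → toℕ v ≡ suc (toℕ u) % suc m →
             (∃[ i ] u ≡ inject₁ i × v ≡ suc i) ⊎ (u ≡ top m × v ≡ zero)
next-cases {m} {u} next with view u
... | ‵fromℕ     = inj₂ (refl , toℕ-injective (trans next (sym (next-top m))))
... | ‵inject₁ i = inj₁ (i , refl , toℕ-injective (trans next (sym (next-inject₁ i))))

module _ (H : Graph) where
  open Graph H using (_~_; _~?_; Vertex; ~-sym)

  IsHom-resp : ∀ G {f g} → f ≗ g → IsHom G H f → IsHom G H g
  IsHom-resp G f≗g hom v w v~w = subst₂ _~_ (f≗g v) (f≗g w) (hom v w v~w)

  isHom-ext : ∀ G → Extensional λ f → ⟦ isHom? G H f ⟧
  isHom-ext G {f} {g} f≗g =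
    ⟦⟧-cong (isHom? G H f) (isHom? G H g) (mk⇔ (IsHom-resp G f≗g) (IsHom-resp G (sym ∘ f≗g)))

  hom-∑ᶠ : ∀ G → hom G H ≡ ∑ᶠ (order G) λ f → ⟦ isHom? G H f ⟧
  hom-∑ᶠ G = count-tabulate (λ k → isHom? G H (finToFun k)) id

  hom-≅ : ∀ {F G} → F ≅ G → hom F H ≡ hom G H
  hom-≅ {F} {G} F≅G = begin
    hom F H                                                 ≡⟨ hom-∑ᶠ F ⟩
    (∑ᶠ (order F) λ f → ⟦ isHom? F H f ⟧)
      ≡⟨ (∑-cong λ k → ⟦⟧-cong (isHom? F H (finToFun k)) (isHom? G H (finToFun k ∘ from′)) (mk⇔ fwd bwd)) ⟩
    (∑ᶠ (order F) λ f → ⟦ isHom? G H (f ∘ (bijection ⟨$⟩ˡ_)) ⟧)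
      ≡⟨ ∑ᶠ-permute (isHom-ext G) bijection ⟨
    (∑ᶠ (order G) λ f → ⟦ isHom? G H f ⟧)                   ≡⟨ hom-∑ᶠ G ⟨
    hom G H                                                 ∎
    where
    open ≡-Reasoning
    open _≅_ F≅G
    module F = Graph F
    module G = Graph G
    from′ : G.Vertex → F.Vertex
    from′ = bijection ⟨$⟩ˡ_
    fwd : ∀ {f} → IsHom F H f → IsHom G H (f ∘ from′)
    fwd hom v w v~w = hom _ _ (from (preserves _ _)
      (subst₂ G._~_ (sym (inverseʳ bijection)) (sym (inverseʳ bijection)) v~w))
    bwd : ∀ {f} → IsHom G H (f ∘ from′) → IsHom F H f
    bwd {f} hom v w v~w = subst₂ _~_ (cong f (inverseˡ bijection)) (cong f (inverseˡ bijection))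
      (hom _ _ (to (preserves v w) v~w))

  hom-∅ᴳ : hom ∅ᴳ H ≡ 1
  hom-∅ᴳ = trans (hom-∑ᶠ ∅ᴳ) (∑ᶠ-zero {q = order H} (isHom-ext ∅ᴳ) λ ())

  hom-⊎ᴳ : ∀ F G → hom (F ⊎ᴳ G) H ≡ hom F H * hom G H
  hom-⊎ᴳ F G = begin
    hom (F ⊎ᴳ G) H                            ≡⟨ hom-∑ᶠ (F ⊎ᴳ G) ⟩
    _                                         ≡⟨ ∑ᶠ-++ m {n} {order H} (isHom-ext (F ⊎ᴳ G)) ⟩
    (∑ᶠ m λ f → ∑ᶠ n λ g → ⟦ isHom? (F ⊎ᴳ G) H (f ++ g) ⟧)
      ≡⟨ (∑-cong₂ λ k l → trans (⟦⟧-cong (isHom? (F ⊎ᴳ G) H _)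
                                         (isHom? F H (finToFun k) ×-dec isHom? G H (finToFun l))
                                         (mk⇔ split (uncurry glue)))
                              (⟦⟧-× (isHom? F H (finToFun k)) (isHom? G H (finToFun l)))) ⟩
    (∑ᶠ m λ f → ∑ᶠ n λ g → ⟦ isHom? F H f ⟧ * ⟦ isHom? G H g ⟧) ≡⟨ ∑-*-∑ _ _ ⟨
    _                                         ≡⟨ cong₂ _*_ (hom-∑ᶠ F) (hom-∑ᶠ G) ⟨
    hom F H * hom G H                         ∎
    where
    open ≡-Reasoning
    m = order F
    n = order G
    module F = Graph F
    module G = Graph G
    module FG = Graph (F ⊎ᴳ G)

    -- The results of `splitAt` enter as variables with equations, so that they can be replaced by
    -- their known values without rewriting inside the homomorphism property.
    component : ∀ {f g} → IsHom (F ⊎ᴳ G) H (f ++ g) → ∀ {x y} (u v : FG.Vertex) →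
                splitAt m u ≡ x → splitAt m v ≡ y →
                Pointwise F._~_ G._~_ x y → [ f , g ]′ x ~ [ f , g ]′ y
    component hom u v refl refl = hom u v

    split : ∀ {f g} → IsHom (F ⊎ᴳ G) H (f ++ g) → IsHom F H f × IsHom G H g
    split hom =
      (λ u v u~v → component hom (u ↑ˡ n) (v ↑ˡ n) (splitAt-↑ˡ m u n) (splitAt-↑ˡ m v n) (inj₁ u~v)) ,
      (λ u v u~v → component hom (m ↑ʳ u) (m ↑ʳ v) (splitAt-↑ʳ m n u) (splitAt-↑ʳ m n v) (inj₂ u~v))

    glue : ∀ {f g} → IsHom F H f → IsHom G H g → IsHom (F ⊎ᴳ G) H (f ++ g)
    glue hf hg u v u~v with splitAt m u | splitAt m v
    glue hf hg u v (inj₁ u~v) | inj₁ x | inj₁ y = hf x y u~v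
    glue hf hg u v (inj₂ u~v) | inj₂ x | inj₂ y = hg x y u~v

  -- walks j x y counts the walks with j interior vertices, so walks j is the
  -- power A^(j+1) of the adjacency matrix.
  adj : Vertex → Vertex → ℕ
  adj u v = ⟦ u ~? v ⟧

  walks : ℕ → Vertex → Vertex → ℕ
  walks zero    x y = adj x y
  walks (suc j) x y = ∑ λ z → adj x z * walks j z y

  Walk : ∀ j → Vertex → (Fin j → Vertex) → Vertex → Set
  Walk zero    x f y = x ~ y
  Walk (suc j) x f y = x ~ f zero × Walk j (f zero) (f ∘ suc) y

  walk? : ∀ j x f y → Dec (Walk j x f y)
  walk? zero    x f y = x ~? y
  walk? (suc j) x f y = (x ~? f zero) ×-dec walk? j (f zero) (f ∘ suc) y

  Walk-resp : ∀ j {x x′ f g y} → x ≡ x′ → f ≗ g → Walk j x f y → Walk j x′ g y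
  Walk-resp zero    refl f≗g x~y = x~y
  Walk-resp (suc j) {x} refl f≗g (x~z , w) = subst (x ~_) (f≗g zero) x~z , Walk-resp j (f≗g zero) (f≗g ∘ suc) w

  walk-ext : ∀ j x y → Extensional λ f → ⟦ walk? j x f y ⟧
  walk-ext j x y f≗g =
    ⟦⟧-cong (walk? j x _ y) (walk? j x _ y) (mk⇔ (Walk-resp j refl f≗g) (Walk-resp j refl (sym ∘ f≗g)))

  ∑ᶠ-walk : ∀ j x y → (∑ᶠ j λ f → ⟦ walk? j x f y ⟧) ≡ walks j x y
  ∑ᶠ-walk zero    x y = ∑ᶠ-zero {F = λ f → ⟦ walk? 0 x f y ⟧} (λ _ → refl) λ ()
  ∑ᶠ-walk (suc j) x y = begin
    (∑ᶠ (suc j) λ f → ⟦ walk? (suc j) x f y ⟧)                ≡⟨ ∑ᶠ-suc (walk-ext (suc j) x y) ⟩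
    (∑ λ z → ∑ᶠ j λ f → ⟦ (x ~? z) ×-dec walk? j z f y ⟧)     ≡⟨ (∑-cong₂ λ z k → ⟦⟧-× (x ~? z) (walk? j z (finToFun k) y)) ⟩
    (∑ λ z → ∑ᶠ j λ f → adj x z * ⟦ walk? j z f y ⟧)          ≡⟨ (∑-cong λ z → *-distribˡ-∑ (adj x z) _) ⟨
    (∑ λ z → adj x z * ∑ᶠ j λ f → ⟦ walk? j z f y ⟧)          ≡⟨ (∑-cong λ z → cong (adj x z *_) (∑ᶠ-walk j z y)) ⟩
    walks (suc j) x y                                         ∎
    where open ≡-Reasoning

  Walk⇔ : ∀ j {x f y} → Walk j x f y ⇔
          ((∀ (i : Fin j) → (x ∷ᶠ f) (inject₁ i) ~ f i) × (x ∷ᶠ f) (top j) ~ y)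
  Walk⇔ zero    = mk⇔ (λ x~y → (λ ()) , x~y) proj₂
  Walk⇔ (suc j) {x} {f} {y} = mk⇔
    (λ { (x~z , w) → (λ { zero → x~z ; (suc i) → trans~ i (proj₁ (to (Walk⇔ j) w) i) })
                 , last (proj₂ (to (Walk⇔ j) w)) })
    (λ { (steps , end) → steps zero , from (Walk⇔ j) ((λ i → untrans~ i (steps (suc i))) , unlast end) })
    where
    -- Rebuilding a map from its head and tail gives back `f` only pointwise; the four transports
    -- below bridge this.
    eq : (f zero ∷ᶠ (f ∘ suc)) ≗ f
    eq zero = refl
    eq (suc i) = refl
    trans~ : ∀ i → (f zero ∷ᶠ (f ∘ suc)) (inject₁ i) ~ f (suc i) → f (inject₁ i) ~ f (suc i)
    trans~ i = subst (_~ f (suc i)) (eq (inject₁ i))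
    untrans~ : ∀ i → f (inject₁ i) ~ f (suc i) → (f zero ∷ᶠ (f ∘ suc)) (inject₁ i) ~ f (suc i)
    untrans~ i = subst (_~ f (suc i)) (sym (eq (inject₁ i)))
    last : (f zero ∷ᶠ (f ∘ suc)) (top j) ~ y → f (top j) ~ y
    last = subst (_~ y) (eq (top j))
    unlast : f (top j) ~ y → (f zero ∷ᶠ (f ∘ suc)) (top j) ~ y
    unlast = subst (_~ y) (sym (eq (top j)))

  IsHom-C⇔ : ∀ m {g : Fin (suc m) → Vertex} → IsHom (C (suc m)) H g ⇔
             ((∀ i → g (inject₁ i) ~ g (suc i)) × g (top m) ~ g zero)
  IsHom-C⇔ m {g} = mk⇔ (λ hom → (λ i → hom _ _ (inj₁ (next-inject₁ i))) , hom _ _ (inj₁ (next-top m)))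
    λ { (steps , end) → λ { u v (inj₁ n) → close steps end (next-cases n)
                          ; u v (inj₂ n) → ~-sym (close steps end (next-cases n)) } }
    where
    close : (∀ i → g (inject₁ i) ~ g (suc i)) → g (top m) ~ g zero → ∀ {u v} →
            (∃[ i ] u ≡ inject₁ i × v ≡ suc i) ⊎ (u ≡ top m × v ≡ zero) → g u ~ g v
    close steps end (inj₁ (i , refl , refl)) = steps i
    close steps end (inj₂ (refl , refl))     = end

  -- Cutting the cycle at vertex zero: once its image `x` is fixed, the other `m` images are the
  -- interior of a walk from `x` back to `x`, the wraparound edge being the last step. The
  -- right-hand side is tr A^(m+1).
  hom-C : ∀ m → hom (C (suc m)) H ≡ ∑ λ x → walks m x x
  hom-C m = begin
    hom (C (suc m)) H                                                     ≡⟨ hom-∑ᶠ (C (suc m)) ⟩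
    (∑ᶠ (suc m) λ f → ⟦ isHom? (C (suc m)) H f ⟧)                         ≡⟨ ∑ᶠ-suc (isHom-ext (C (suc m))) ⟩
    (∑ λ x → ∑ᶠ m λ f → ⟦ isHom? (C (suc m)) H (x ∷ᶠ f) ⟧)
      ≡⟨ (∑-cong₂ λ x k → ⟦⟧-cong (isHom? (C (suc m)) H (x ∷ᶠ finToFun k)) (walk? m x (finToFun k) x)
            (mk⇔ (λ hom → from (Walk⇔ m) (to (IsHom-C⇔ m) hom)) (λ w → from (IsHom-C⇔ m) (to (Walk⇔ m) w)))) ⟩
    (∑ λ x → ∑ᶠ m λ f → ⟦ walk? m x f x ⟧)                                ≡⟨ (∑-cong λ x → ∑ᶠ-walk m x x) ⟩
    (∑ λ x → walks m x x)                                                 ∎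
    where open ≡-Reasoning

-- Inequalities between walk counts

opaque
  unfolding ∑

  term≤∑ : ∀ {n} (f : Fin n → ℕ) i → f i ≤ ∑ f
  term≤∑ f zero    = m≤m+n (f zero) _
  term≤∑ f (suc i) = ≤-trans (term≤∑ (f ∘ suc) i) (m≤n+m _ (f zero))

∑-flatten : ∀ {m n} (F : Fin m → Fin n → ℕ) →
            (∑ λ x → ∑ (F x)) ≡ ∑ λ k → F (quotient n k) (remainder {m} n k)
∑-flatten {m} {n} F = sym (trans (∑-* m {n} _) (∑-cong₂ λ x y →
  cong₂ F (cong proj₁ (remQuot-combine x y)) (cong proj₂ (remQuot-combine x y))))

cauchy-schwarz₂ : ∀ {m n} (X Y : Fin m → Fin n → ℕ) →
  (∑ λ x → ∑ λ y → X x y * Y x y) * (∑ λ x → ∑ λ y → X x y * Y x y) ≤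
  (∑ λ x → ∑ λ y → X x y * X x y) * (∑ λ x → ∑ λ y → Y x y * Y x y)
cauchy-schwarz₂ {m} {n} X Y = subst₂ _≤_
  (sym (cong₂ _*_ (∑-flatten _) (∑-flatten _)))
  (sym (cong₂ _*_ (∑-flatten _) (∑-flatten _)))
  (CauchySchwarz.inequality (λ k → X (quotient n k) (remainder {m} n k))
                            (λ k → Y (quotient n k) (remainder {m} n k)))

-- Serves to turn "codegree squared equals the product of the degrees" into equality of codegree and
-- degree, given that the codegree is at most either degree.
square-tight : ∀ {b p q} → b ≤ q → 0 < q → b * b ≡ p * q → p ≤ b
square-tight {b} {p} {q} b≤q 0<q b²≡pq =
  *-cancelʳ-≤ p b q {{>-nonZero 0<q}} (subst (_≤ b * q) b²≡pq (*-monoʳ-≤ b b≤q))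

square-* : ∀ x y → (x * y) * (x * y) ≡ x * (x * (y * y))
square-* x y = trans ([m*n]*[o*p]≡[m*o]*[n*p] x y x y) (*-assoc x x (y * y))

module WalkCounts (H : Graph) where
  open Graph H using (_~_; _~?_; Vertex; ~-sym)

  private
    W : ℕ → Vertex → Vertex → ℕ
    W = walks H
    A = adj H

  walks-+ : ∀ i j x y → W (suc (i + j)) x y ≡ ∑ λ z → W i x z * W j z y
  walks-+ zero    j x y = refl
  walks-+ (suc i) j x y = begin
    (∑ λ z → A x z * W (suc (i + j)) z y)            ≡⟨ (∑-cong λ z → cong (A x z *_) (walks-+ i j z y)) ⟩
    (∑ λ z → A x z * ∑ λ w → W i z w * W j w y)      ≡⟨ (∑-cong λ z → *-distribˡ-∑ (A x z) _) ⟩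
    (∑ λ z → ∑ λ w → A x z * (W i z w * W j w y))    ≡⟨ ∑-comm (λ z w → A x z * (W i z w * W j w y)) ⟩
    (∑ λ w → ∑ λ z → A x z * (W i z w * W j w y))    ≡⟨ (∑-cong₂ λ w z → *-assoc (A x z) (W i z w) (W j w y)) ⟨
    (∑ λ w → ∑ λ z → (A x z * W i z w) * W j w y)    ≡⟨ (∑-cong λ w → *-distribʳ-∑ (W j w y) (λ z → A x z * W i z w)) ⟨
    (∑ λ w → W (suc i) x w * W j w y)                ∎
    where open ≡-Reasoning

  adj-sym : ∀ x y → A x y ≡ A y x
  adj-sym x y with x ~? y | y ~? x
  ... | yes _   | yes _   = refl
  ... | no  _   | no  _   = refl
  ... | yes x~y | no  y≁x = contradiction (~-sym x~y) y≁x
  ... | no  x≁y | yes y~x = contradiction (~-sym y~x) x≁y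

  walks-sym : ∀ j x y → W j x y ≡ W j y x
  walks-sym zero    x y = adj-sym x y
  walks-sym (suc j) x y = begin
    (∑ λ z → A x z * W j z y)   ≡⟨ (∑-cong λ z → cong₂ _*_ (adj-sym x z) (walks-sym j z y)) ⟩
    (∑ λ z → A z x * W j y z)   ≡⟨ (∑-cong λ z → *-comm (A z x) (W j y z)) ⟩
    (∑ λ z → W j y z * A z x)   ≡⟨ walks-+ j 0 y x ⟨
    W (suc (j + 0)) y x         ≡⟨ cong (λ k → W (suc k) y x) (+-identityʳ j) ⟩
    W (suc j) y x               ∎
    where open ≡-Reasoning

  closedWalks : ℕ → ℕ
  closedWalks m = ∑ λ x → W m x x

  -- Equals tr A^(2j+2), since A is symmetric.
  normSq : ℕ → ℕ
  normSq j = ∑ λ x → ∑ λ y → W j x y * W j x y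

  private
    c = closedWalks
    N = normSq

  -- By symmetry of `A`, the trace of A^(i+1) A^(j+1) is the Frobenius inner product of the two
  -- factors, so Cauchy-Schwarz applies to it.
  closedWalks-+ : ∀ i j → c (suc (i + j)) ≡ ∑ λ x → ∑ λ y → W i x y * W j x y
  closedWalks-+ i j = trans (∑-cong λ x → walks-+ i j x x)
    (∑-cong₂ λ x y → cong (W i x y *_) (walks-sym j y x))

  closedWalks²≤ : ∀ i j → c (suc (i + j)) * c (suc (i + j)) ≤ N i * N j
  closedWalks²≤ i j = subst (λ t → t * t ≤ N i * N j) (sym (closedWalks-+ i j)) (cauchy-schwarz₂ (W i) (W j))

  private
    rowSq colSq : ℕ → Vertex → ℕ
    rowSq i u = ∑ λ w → W i u w * W i u w
    colSq j v = ∑ λ w → W j w v * W j w v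

    walks²≤ : ∀ i j u v → W (suc (i + j)) u v * W (suc (i + j)) u v ≤ rowSq i u * colSq j v
    walks²≤ i j u v = subst (λ t → t * t ≤ rowSq i u * colSq j v) (sym (walks-+ i j u v))
      (CauchySchwarz.inequality (W i u) (λ w → W j w v))

    normSq-* : ∀ i j → N i * N j ≡ ∑ λ u → ∑ λ v → rowSq i u * colSq j v
    normSq-* i j = trans (cong (N i *_) (∑-comm λ x y → W j x y * W j x y)) (∑-*-∑ (rowSq i) (colSq j))

  -- Each entry of a matrix product is a row times a column. Cauchy-Schwarz bounds its square by the
  -- product of their squared norms, and summing over all entries factors.
  normSq-submult : ∀ i j → N (suc (i + j)) ≤ N i * N j
  normSq-submult i j = ≤-trans (∑-mono λ u → ∑-mono λ v → walks²≤ i j u v) (≤-reflexive (sym (normSq-* i j)))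

  -- Tightness of the sum makes Cauchy-Schwarz tight at every entry, so row `u` of the first factor
  -- is proportional to column `v` of the second; cross-multiplication expresses this without
  -- division.
  normSq-tight : ∀ i j → N (suc (i + j)) ≡ N i * N j → ∀ u v x y → W i u x * W j y v ≡ W i u y * W j x v
  normSq-tight i j eq u v = CauchySchwarz.equality (W i u) (λ w → W j w v)
    (subst (λ t → t * t ≡ rowSq i u * colSq j v) (walks-+ i j u v)
      (∑-tight (walks²≤ i j u) (∑-tight (λ u → ∑-mono (walks²≤ i j u)) (trans eq (normSq-* i j)) u) v))

  private
    h = N 1

  -- In powers of `A` this reads ‖A^(j+2)‖^4 ≤ (tr A^4)^(j+2); the index of `N` is one less than the
  -- exponent.
  normSq²≤ : ∀ j → N (suc j) * N (suc j) ≤ h ^ (2 + j)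
  normSq²≤ zero = ≤-reflexive (cong (h *_) (sym (*-identityʳ h)))
  normSq²≤ (suc zero) = begin
    -- `N 2` is tr A^6, which is rewritten as a closed walk count in order to be split unevenly, as
    -- A^2 against A^4.
    N 2 * N 2        ≡⟨ cong₂ _*_ (closedWalks-+ 2 2) (closedWalks-+ 2 2) ⟨
    c 5 * c 5        ≤⟨ closedWalks²≤ 1 3 ⟩
    h * N 3          ≤⟨ *-monoʳ-≤ h (normSq-submult 1 1) ⟩
    h * (h * h)      ≡⟨ cong (λ t → h * (h * t)) (*-identityʳ h) ⟨
    h ^ 3            ∎
    where open ≤-Reasoning
  normSq²≤ (suc (suc j)) = begin
    N (3 + j) * N (3 + j)                ≤⟨ *-mono-≤ (normSq-submult 1 (suc j)) (normSq-submult 1 (suc j)) ⟩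
    (h * N (suc j)) * (h * N (suc j))    ≡⟨ square-* h (N (suc j)) ⟩
    h * (h * (N (suc j) * N (suc j)))    ≤⟨ *-monoʳ-≤ h (*-monoʳ-≤ h (normSq²≤ j)) ⟩
    h ^ (4 + j)                          ∎
    where open ≤-Reasoning

  module Strict (0<h : 0 < h) (gap : N 3 < h * h) where
    private instance
      h≢0 : NonZero h
      h≢0 = >-nonZero 0<h

    normSq²< : ∀ j → N (2 + j) * N (2 + j) < h ^ (3 + j)
    normSq²< zero = begin-strict
      N 2 * N 2        ≡⟨ cong₂ _*_ (closedWalks-+ 2 2) (closedWalks-+ 2 2) ⟨
      c 5 * c 5        ≤⟨ closedWalks²≤ 1 3 ⟩
      h * N 3          <⟨ *-monoʳ-< h gap ⟩
      h * (h * h)      ≡⟨ cong (λ t → h * (h * t)) (*-identityʳ h) ⟨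
      h ^ 3            ∎
      where open ≤-Reasoning
    normSq²< (suc zero) = begin-strict
      N 3 * N 3             <⟨ *-mono-< gap gap ⟩
      (h * h) * (h * h)     ≡⟨ *-assoc h h (h * h) ⟩
      h * (h * (h * h))     ≡⟨ cong (λ t → h * (h * (h * t))) (*-identityʳ h) ⟨
      h ^ 4                 ∎
      where open ≤-Reasoning
    normSq²< (suc (suc j)) = begin-strict
      N (4 + j) * N (4 + j)                ≤⟨ *-mono-≤ (normSq-submult 1 (2 + j)) (normSq-submult 1 (2 + j)) ⟩
      (h * N (2 + j)) * (h * N (2 + j))    ≡⟨ square-* h (N (2 + j)) ⟩
      h * (h * (N (2 + j) * N (2 + j)))    <⟨ *-monoʳ-< h (*-monoʳ-< h (normSq²< j)) ⟩
      h ^ (5 + j)                          ∎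
      where open ≤-Reasoning

  private
    closedWalks⁴≤ : ∀ j → c (3 + j) ^ 4 ≤ (h * h) * (N (suc j) * N (suc j))
    closedWalks⁴≤ j = begin
      c (3 + j) ^ 4                                        ≡⟨ fourth (c (3 + j)) ⟩
      (c (3 + j) * c (3 + j)) * (c (3 + j) * c (3 + j))
        ≤⟨ *-mono-≤ (closedWalks²≤ 1 (suc j)) (closedWalks²≤ 1 (suc j)) ⟩
      (h * N (suc j)) * (h * N (suc j))
        ≡⟨ [m*n]*[o*p]≡[m*o]*[n*p] h (N (suc j)) h (N (suc j)) ⟩
      (h * h) * (N (suc j) * N (suc j))                    ∎
      where
      open ≤-Reasoning
      fourth : ∀ x → x ^ 4 ≡ (x * x) * (x * x)
      fourth = solve 1 (λ x → x :^ 4 := (x :* x) :* (x :* x)) refl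
        where open +-*-Solver

  closedWalks≤ : ∀ j → c (3 + j) ^ 4 ≤ h ^ (4 + j)
  closedWalks≤ j = begin
    c (3 + j) ^ 4                          ≤⟨ closedWalks⁴≤ j ⟩
    (h * h) * (N (suc j) * N (suc j))      ≤⟨ *-monoʳ-≤ (h * h) (normSq²≤ j) ⟩
    (h * h) * h ^ (2 + j)                  ≡⟨ *-assoc h h _ ⟩
    h ^ (4 + j)                            ∎
    where open ≤-Reasoning

  closedWalks< : 0 < h → N 3 < h * h → ∀ j → c (4 + j) ^ 4 < h ^ (5 + j)
  closedWalks< 0<h gap j = begin-strict
    c (4 + j) ^ 4                          ≤⟨ closedWalks⁴≤ (suc j) ⟩
    (h * h) * (N (2 + j) * N (2 + j))      <⟨ *-monoʳ-< (h * h) (Strict.normSq²< 0<h gap j) ⟩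
    (h * h) * h ^ (3 + j)                  ≡⟨ *-assoc h h _ ⟩
    h ^ (5 + j)                            ∎
    where
    open ≤-Reasoning
    instance
      h²≢0 : NonZero (h * h)
      h²≢0 = m*n≢0 h h {{>-nonZero 0<h}} {{>-nonZero 0<h}}

  module _ (noIso : NoIsolatedVertices H) where

    neighbour : ∀ v → ∃[ w ] v ~ w
    neighbour v = decidable-stable (any? (v ~?_)) (noIso v)

    adj-~ : ∀ {u v} → u ~ v → A u v ≡ 1
    adj-~ {u} {v} u~v with u ~? v
    ... | yes _   = refl
    ... | no  u≁v = contradiction u~v u≁v

    degree>0 : ∀ v → 0 < W 1 v v
    degree>0 v = let w , v~w = neighbour v in
      ≤-trans (≤-reflexive (sym (cong₂ _*_ (adj-~ v~w) (adj-~ (~-sym v~w))))) (term≤∑ (λ z → A v z * A z v) w)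

    normSq1>0 : Vertex → 0 < h
    normSq1>0 v = ≤-trans (*-mono-< (degree>0 v) (degree>0 v))
      (≤-trans (term≤∑ (λ y → W 1 v y * W 1 v y) v) (term≤∑ (λ x → ∑ λ y → W 1 x y * W 1 x y) v))

    private
      -- Summed over `z`, the two sides are the codegree of `u` and `v` and the degree of `u`. A
      -- tight term at a neighbour `z` of `u` makes `z` a neighbour of `v` too.
      codegree-term : ∀ u v z → A u z * A z v ≤ A u z * A z u × (A u z * A z v ≡ A u z * A z u → u ~ z → z ~ v)
      codegree-term u v z with u ~? z | z ~? u | z ~? v
      ... | no  u≁z | _       | _       = z≤n , λ _ u~z → contradiction u~z u≁z
      ... | yes u~z | no  z≁u | _       = contradiction (~-sym u~z) z≁u
      ... | yes _   | yes _   | yes z~v = s≤s z≤n , λ _ _ → z~v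
      ... | yes _   | yes _   | no  _   = z≤n , λ ()

    codegree≤degree : ∀ u v → W 1 u v ≤ W 1 u u
    codegree≤degree u v = ∑-mono λ z → proj₁ (codegree-term u v z)

    -- Equality makes the codegree of any u and v equal to both degrees, so
    -- all vertices have the same neighbourhood.
    complete : N 3 ≡ h * h → ∀ u v → u ~ v
    -- `twins` makes the far endpoint of an edge adjacent to every vertex. Applied to the edge from
    -- `u` to `w` it returns the edge from `w` to `u`, whose far endpoint is `u`.
    complete eq u v = let w , u~w = neighbour u in twins (twins u~w u) v
      where
      twins : ∀ {u z} → u ~ z → ∀ v → z ~ v
      twins {u} {z} u~z v = proj₂ (codegree-term u v z) (∑-tight (λ z → proj₁ (codegree-term u v z)) deg≡ z) u~z
        where
        W≤ : W 1 u v ≤ W 1 v v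
        W≤ = subst (_≤ W 1 v v) (walks-sym 1 v u) (codegree≤degree v u)
        deg≡ : W 1 u v ≡ W 1 u u
        deg≡ = ≤-antisym (codegree≤degree u v)
          (square-tight W≤ (degree>0 v) (sym (normSq-tight 1 1 eq u v u v)))

    incomplete⇒gap : ¬ (∀ u v → u ~ v) → N 3 < h * h
    incomplete⇒gap incomplete = ≤∧≢⇒< (normSq-submult 1 1) (incomplete ∘ complete)

-- Decomposition of 2-regular graphs into cycles

infix 4 _≈ᴿ_

-- Isomorphism of relations on arbitrary types. The algebra of disjoint unions is done on sum types,
-- where it is plain case analysis, and only then transported to the vertex sets `Fin (m + n)`.
record _≈ᴿ_ {A B : Set} (R : Rel A 0ℓ) (S : Rel B 0ℓ) : Set where
  field
    bijection : A ↔ B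
    preserves : ∀ x y → R x y ⇔ S (Inverse.to bijection x) (Inverse.to bijection y)

open _≈ᴿ_

≈ᴿ-refl : ∀ {A} {R : Rel A 0ℓ} → R ≈ᴿ R
≈ᴿ-refl = record { bijection = ↔-id _ ; preserves = λ _ _ → ⇔-id _ }

≈ᴿ-sym : ∀ {A B} {R : Rel A 0ℓ} {S : Rel B 0ℓ} → R ≈ᴿ S → S ≈ᴿ R
≈ᴿ-sym {R = R} {S} R≈S = record
  { bijection = ↔-sym (bijection R≈S)
  ; preserves = λ x y → ⇔-sym (subst₂ (λ x′ y′ → R (f⁻¹ x) (f⁻¹ y) ⇔ S x′ y′) (inverseˡ′ x) (inverseˡ′ y)
                                      (preserves R≈S (f⁻¹ x) (f⁻¹ y)))
  }
  where
  f⁻¹ = Inverse.from (bijection R≈S)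
  inverseˡ′ = Inverse.strictlyInverseˡ (bijection R≈S)

≈ᴿ-trans : ∀ {A B D} {R : Rel A 0ℓ} {S : Rel B 0ℓ} {T : Rel D 0ℓ} → R ≈ᴿ S → S ≈ᴿ T → R ≈ᴿ T
≈ᴿ-trans R≈S S≈T = record
  { bijection = bijection S≈T ↔-∘ bijection R≈S
  ; preserves = λ x y → preserves S≈T _ _ ⇔-∘ preserves R≈S x y
  }

Pointwise-cong : ∀ {A A′ B B′} {R : Rel A 0ℓ} {R′ : Rel A′ 0ℓ} {S : Rel B 0ℓ} {S′ : Rel B′ 0ℓ} →
                 R ≈ᴿ R′ → S ≈ᴿ S′ → Pointwise R S ≈ᴿ Pointwise R′ S′
Pointwise-cong R≈R′ S≈S′ = record
  { bijection = bijection R≈R′ ⊎-↔ bijection S≈S′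
  ; preserves = λ where
      (inj₁ x) (inj₁ y) → mk⇔ (λ { (inj₁ r) → inj₁ (to (preserves R≈R′ x y) r) })
                              (λ { (inj₁ r) → inj₁ (from (preserves R≈R′ x y) r) })
      (inj₁ x) (inj₂ y) → mk⇔ (λ ()) (λ ())
      (inj₂ x) (inj₁ y) → mk⇔ (λ ()) (λ ())
      (inj₂ x) (inj₂ y) → mk⇔ (λ { (inj₂ s) → inj₂ (to (preserves S≈S′ x y) s) })
                              (λ { (inj₂ s) → inj₂ (from (preserves S≈S′ x y) s) })
  }

Pointwise-comm : ∀ {A B} {R : Rel A 0ℓ} {S : Rel B 0ℓ} → Pointwise R S ≈ᴿ Pointwise S R
Pointwise-comm = record
  { bijection = ⊎-comm _ _
  ; preserves = λ where
      (inj₁ x) (inj₁ y) → mk⇔ (λ { (inj₁ r) → inj₂ r }) (λ { (inj₂ r) → inj₁ r })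
      (inj₁ x) (inj₂ y) → mk⇔ (λ ()) (λ ())
      (inj₂ x) (inj₁ y) → mk⇔ (λ ()) (λ ())
      (inj₂ x) (inj₂ y) → mk⇔ (λ { (inj₂ s) → inj₁ s }) (λ { (inj₁ s) → inj₂ s })
  }

Pointwise-assoc : ∀ {A B D} {R : Rel A 0ℓ} {S : Rel B 0ℓ} {T : Rel D 0ℓ} →
                  Pointwise (Pointwise R S) T ≈ᴿ Pointwise R (Pointwise S T)
Pointwise-assoc {A} {B} {D} {R} {S} {T} = record
  { bijection = ⊎-assoc 0ℓ A B D
  ; preserves = λ x y → mk⇔ (fwd x y) (bwd x y)
  }
  where
  α : (A ⊎ B) ⊎ D → A ⊎ (B ⊎ D)
  α = Inverse.to (⊎-assoc 0ℓ A B D)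

  fwd : ∀ x y → Pointwise (Pointwise R S) T x y → Pointwise R (Pointwise S T) (α x) (α y)
  fwd _ _ (inj₁ (inj₁ r)) = inj₁ r
  fwd _ _ (inj₁ (inj₂ s)) = inj₂ (inj₁ s)
  fwd _ _ (inj₂ t)        = inj₂ (inj₂ t)

  bwd : ∀ x y → Pointwise R (Pointwise S T) (α x) (α y) → Pointwise (Pointwise R S) T x y
  bwd (inj₁ (inj₁ _)) (inj₁ (inj₁ _)) (inj₁ r)        = inj₁ (inj₁ r)
  bwd (inj₁ (inj₂ _)) (inj₁ (inj₂ _)) (inj₂ (inj₁ s)) = inj₁ (inj₂ s)
  bwd (inj₂ _)        (inj₂ _)        (inj₂ (inj₂ t)) = inj₂ t
  bwd (inj₁ (inj₁ _)) (inj₁ (inj₂ _)) ()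
  bwd (inj₁ (inj₁ _)) (inj₂ _)        ()
  bwd (inj₁ (inj₂ _)) (inj₁ (inj₁ _)) ()
  bwd (inj₁ (inj₂ _)) (inj₂ _)        (inj₂ ())
  bwd (inj₂ _)        (inj₁ (inj₁ _)) ()
  bwd (inj₂ _)        (inj₁ (inj₂ _)) (inj₂ ())

≅⇒≈ᴿ : ∀ {F G} → F ≅ G → Graph._~_ F ≈ᴿ Graph._~_ G
≅⇒≈ᴿ F≅G = record { bijection = _≅_.bijection F≅G ; preserves = _≅_.preserves F≅G }

≈ᴿ⇒≅ : ∀ {F G} → Graph._~_ F ≈ᴿ Graph._~_ G → F ≅ G
≈ᴿ⇒≅ F≈G = record { bijection = bijection F≈G ; preserves = preserves F≈G }

-- Adjacency in a disjoint union is defined through `splitAt`, which is the forward map of `+↔⊎`, so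
-- the two relations coincide by computation.
⊎ᴳ-≈ᴿ : ∀ F G → Graph._~_ (F ⊎ᴳ G) ≈ᴿ Pointwise (Graph._~_ F) (Graph._~_ G)
⊎ᴳ-≈ᴿ F G = record { bijection = +↔⊎ ; preserves = λ _ _ → ⇔-id _ }

≅-sym : ∀ {F G} → F ≅ G → G ≅ F
≅-sym F≅G = ≈ᴿ⇒≅ (≈ᴿ-sym (≅⇒≈ᴿ F≅G))

≅-trans : ∀ {E F G} → E ≅ F → F ≅ G → E ≅ G
≅-trans E≅F F≅G = ≈ᴿ⇒≅ (≈ᴿ-trans (≅⇒≈ᴿ E≅F) (≅⇒≈ᴿ F≅G))

≅-refl : ∀ {G} → G ≅ G
≅-refl = ≈ᴿ⇒≅ ≈ᴿ-refl

⊎ᴳ-cong : ∀ {F F′ G G′} → F ≅ F′ → G ≅ G′ → F ⊎ᴳ G ≅ F′ ⊎ᴳ G′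
⊎ᴳ-cong {F} {F′} {G} {G′} F≅F′ G≅G′ = ≈ᴿ⇒≅ (≈ᴿ-trans (⊎ᴳ-≈ᴿ F G)
  (≈ᴿ-trans (Pointwise-cong (≅⇒≈ᴿ F≅F′) (≅⇒≈ᴿ G≅G′)) (≈ᴿ-sym (⊎ᴳ-≈ᴿ F′ G′))))

⊎ᴳ-comm : ∀ F G → F ⊎ᴳ G ≅ G ⊎ᴳ F
⊎ᴳ-comm F G = ≈ᴿ⇒≅ (≈ᴿ-trans (⊎ᴳ-≈ᴿ F G) (≈ᴿ-trans Pointwise-comm (≈ᴿ-sym (⊎ᴳ-≈ᴿ G F))))

⊎ᴳ-assoc : ∀ E F G → (E ⊎ᴳ F) ⊎ᴳ G ≅ E ⊎ᴳ (F ⊎ᴳ G)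
⊎ᴳ-assoc E F G = ≈ᴿ⇒≅
  (≈ᴿ-trans (⊎ᴳ-≈ᴿ (E ⊎ᴳ F) G)
  (≈ᴿ-trans (Pointwise-cong (⊎ᴳ-≈ᴿ E F) ≈ᴿ-refl)
  (≈ᴿ-trans Pointwise-assoc
  (≈ᴿ-trans (Pointwise-cong ≈ᴿ-refl (≈ᴿ-sym (⊎ᴳ-≈ᴿ F G)))
            (≈ᴿ-sym (⊎ᴳ-≈ᴿ E (F ⊎ᴳ G)))))))

-- Degree two as exactly two neighbours

record HasTwo {A : Set} (P : A → Set) : Set where
  constructor hasTwo
  field
    {a b} : A
    a≢b   : a ≢ b
    Pa    : P a
    Pb    : P b
    only  : ∀ {x} → P x → x ≡ a ⊎ x ≡ b

  -- The form in which degree two is used: any two distinct known neighbours can take the place of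
  -- the stored witnesses.
  third : ∀ {x y z} → P x → P y → P z → x ≢ y → z ≡ x ⊎ z ≡ y
  third Px Py Pz x≢y with only Px | only Py | only Pz
  ... | inj₁ refl | inj₁ refl | _         = contradiction refl x≢y
  ... | inj₂ refl | inj₂ refl | _         = contradiction refl x≢y
  ... | inj₁ refl | inj₂ refl | z≡        = z≡
  ... | inj₂ refl | inj₁ refl | inj₁ z≡a  = inj₂ z≡a
  ... | inj₂ refl | inj₁ refl | inj₂ z≡b  = inj₁ z≡b

∑⟦⟧≡0 : ∀ {n} {P : Fin n → Set} (P? : Decidable P) → (∑ λ i → ⟦ P? i ⟧) ≡ 0 → ∀ i → ¬ P i
∑⟦⟧≡0 P? eq i Pi with P? i | subst (⟦ P? i ⟧ ≤_) eq (term≤∑ (λ i → ⟦ P? i ⟧) i)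
... | yes _  | ()
... | no ¬Pi | _ = ¬Pi Pi

∑⟦⟧≡1 : ∀ {n} {P : Fin n → Set} (P? : Decidable P) → (∑ λ i → ⟦ P? i ⟧) ≡ 1 →
        ∃[ a ] P a × (∀ {i} → P i → i ≡ a)
∑⟦⟧≡1 {zero} P? eq with trans (sym (∑-zero _)) eq
... | ()
∑⟦⟧≡1 {suc n} {P} P? eq with P? zero | trans (sym (∑-suc _)) eq
... | yes P0 | eq′ = zero , P0 , only
  where
  only : ∀ {i} → P i → i ≡ zero
  only {zero}  _  = refl
  only {suc i} Pi = contradiction Pi (∑⟦⟧≡0 (P? ∘ suc) (ℕ.suc-injective eq′) i)
... | no ¬P0 | eq′ with ∑⟦⟧≡1 (P? ∘ suc) eq′
... | a , Pa , onlyₐ = suc a , Pa , only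
  where
  only : ∀ {i} → P i → i ≡ suc a
  only {zero}  P0 = contradiction P0 ¬P0
  only {suc i} Pi = cong suc (onlyₐ Pi)

∑⟦⟧≡2 : ∀ {n} {P : Fin n → Set} (P? : Decidable P) → (∑ λ i → ⟦ P? i ⟧) ≡ 2 → HasTwo P
∑⟦⟧≡2 {zero} P? eq with trans (sym (∑-zero _)) eq
... | ()
∑⟦⟧≡2 {suc n} {P} P? eq with P? zero | trans (sym (∑-suc _)) eq
∑⟦⟧≡2 {suc n} {P} P? eq | yes P0 | eq′ with ∑⟦⟧≡1 (P? ∘ suc) (ℕ.suc-injective eq′)
... | b , Pb , onlyᵇ = hasTwo (λ ()) P0 Pb only
  where
  only : ∀ {i} → P i → i ≡ zero ⊎ i ≡ suc b
  only {zero}  _  = inj₁ refl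
  only {suc i} Pi = inj₂ (cong suc (onlyᵇ Pi))
∑⟦⟧≡2 {suc n} {P} P? eq | no ¬P0 | eq′ with ∑⟦⟧≡2 (P? ∘ suc) eq′
... | hasTwo {a} {b} a≢b Pa Pb onlyᵃᵇ = hasTwo (a≢b ∘ suc-injective) Pa Pb only
  where
  only : ∀ {i} → P i → i ≡ suc a ⊎ i ≡ suc b
  only {zero}  P0 = contradiction P0 ¬P0
  only {suc i} Pi with onlyᵃᵇ Pi
  ... | inj₁ i≡a = inj₁ (cong suc i≡a)
  ... | inj₂ i≡b = inj₂ (cong suc i≡b)

TwoNeighbours : Graph → Set
TwoNeighbours G = ∀ v → HasTwo (v ~_)
  where open Graph G

regular⇒twoNeighbours : ∀ {G} → Regular 2 G → TwoNeighbours G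
regular⇒twoNeighbours {G} regular v =
  ∑⟦⟧≡2 (v ~?_) (trans (sym (count-tabulate (v ~?_) id)) (regular v))
  where open Graph G

-- Finding a cycle that is a whole component

Least : (ℕ → Set) → ℕ → Set
Least P n = P n × (∀ {i} → i < n → ¬ P i)

least : ∀ {P : ℕ → Set} → Decidable P → ∀ {n} → P n → ∃[ m ] Least P m
least {P} P? {n} Pn with search (suc n)
  where
  search : ∀ n → (∃[ m ] Least P m) ⊎ (∀ {i} → i < n → ¬ P i)
  search zero = inj₂ λ ()
  search (suc n) with search n
  ... | inj₁ found = inj₁ found
  ... | inj₂ none with P? n
  ...   | yes Pn = inj₁ (n , Pn , none)
  ...   | no ¬Pn = inj₂ λ {i} i<1+n → λ Pi → case (m≤n⇒m<n∨m≡n (s≤s⁻¹ i<1+n)) Pi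
    where
    case : ∀ {i} → i < n ⊎ i ≡ n → ¬ P i
    case (inj₁ i<n)  = none i<n
    case (inj₂ refl) = ¬Pn
... | inj₁ found = found
... | inj₂ none  = contradiction Pn (none ≤-refl)

-- Used to relabel a graph so that a given cycle comes first. The value `f zero` is punched out, the
-- rest is extended recursively, and `f zero` is inserted again; `r` counts the points outside the
-- image.
extend : ∀ k {n} {f : Fin k → Fin n} → Injective _≡_ _≡_ f →
         ∃[ r ] Σ[ π ∈ Permutation (k + r) n ] (∀ i → π ⟨$⟩ʳ (i ↑ˡ r) ≡ f i)
extend zero    {n} f-inj = n , Perm.id , λ ()
extend (suc k) {zero} {f} f-inj with f zero
... | ()
extend (suc k) {suc n} {f} f-inj = r , insert zero (f zero) π , agree
  where
  f₀≢ : ∀ i → f zero ≢ f (suc i)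
  f₀≢ i eq with f-inj eq
  ... | ()
  rec = extend k {f = λ i → punchOut (f₀≢ i)}
    λ {i} {j} eq → suc-injective (f-inj (punchOut-injective (f₀≢ i) (f₀≢ j) eq))
  r = proj₁ rec
  π = proj₁ (proj₂ rec)
  agree : ∀ i → insert zero (f zero) π ⟨$⟩ʳ (i ↑ˡ r) ≡ f i
  agree zero    = refl
  agree (suc i) = trans (insert-punchIn zero (f zero) π (i ↑ˡ r))
    (trans (cong (punchIn (f zero)) (proj₂ (proj₂ rec) i)) (punchIn-punchOut (f₀≢ i)))

-- `closed` says more than the absence of chords: no edge leaves the cycle, so it is a connected
-- component.
record InducedCycle (G : Graph) : Set where
  open Graph G using (_~_; Vertex)
  field
    m         : ℕ
    cycle     : Fin (3 + m) → Vertex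
    injective : Injective _≡_ _≡_ cycle
    sound     : ∀ {i j} → Graph._~_ (C (3 + m)) i j → cycle i ~ cycle j
    closed    : ∀ {i v} → cycle i ~ v → ∃[ j ] v ≡ cycle j × Graph._~_ (C (3 + m)) i j

module CycleThrough (G : Graph) (simple : Simple G) (two : TwoNeighbours G) (v₀ : Graph.Vertex G) where
  open Graph G using (_~_; _~?_; ~-sym; Vertex)

  private
    other : ∀ u v → ∃[ w ] v ~ w × w ≢ u
    other u v with two v
    ... | hasTwo {a} {b} a≢b v~a v~b _ with a ≟ u
    ...   | yes refl = b , v~b , a≢b ∘ sym
    ...   | no  a≢u  = a , v~a , a≢u

    -- A walk that never turns back. The next vertex depends on the last edge, hence the state is a
    -- pair of consecutive vertices.
    dart : ℕ → Vertex × Vertex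
    dart zero    = v₀ , HasTwo.a (two v₀)
    dart (suc i) = let u , v = dart i in v , proj₁ (other u v)

    w : ℕ → Vertex
    w i = proj₁ (dart i)

    step : ∀ i → w i ~ w (suc i)
    step zero    = HasTwo.Pa (two v₀)
    step (suc i) = proj₁ (proj₂ (other (w i) (w (suc i))))

    turn : ∀ i → w (2 + i) ≢ w i
    turn i = proj₂ (proj₂ (other (w i) (w (suc i))))

    w-suc≢ : ∀ i → w i ≢ w (suc i)
    w-suc≢ i eq = simple (w i) (subst (w i ~_) (sym eq) (step i))

    Repeats : ℕ → Set
    Repeats k = ∃[ j ] w (toℕ {k} j) ≡ w k

    repeats : ∀ {j k} → j < k → w j ≡ w k → Repeats k
    repeats j<k eq = fromℕ< j<k , trans (cong w (toℕ-fromℕ< j<k)) eq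

    firstRepeat : ∃[ k ] Least Repeats k
    firstRepeat = let _ , _ , i<j , eq = pigeonhole (n<1+n (order G)) (w ∘ toℕ) in
      least (λ k → any? λ j → w (toℕ j) ≟ w k) (repeats i<j eq)

    module _ {k} (fresh : ∀ {i} → i < k → ¬ Repeats i) where
      w-injective : ∀ {i j} → i < k → j < k → w i ≡ w j → i ≡ j
      w-injective {i} {j} i<k j<k eq with <-cmp i j
      ... | tri< i<j _ _ = contradiction (repeats i<j eq) (fresh j<k)
      ... | tri≈ _ i≡j _ = i≡j
      ... | tri> _ _ j<i = contradiction (repeats j<i (sym eq)) (fresh i<k)

    -- The first vertex to be repeated is v₀: a repeated inner vertex would
    -- have a third neighbour.
    closes : ∀ {j k} → (∀ {i} → i < k → ¬ Repeats i) → j < k → w j ≡ w k → j ≡ 0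
    closes {zero} fresh j<k eq = refl
    closes {suc i} {suc k} fresh j<k eq
      with HasTwo.third (two (w (suc i))) (~-sym (step i)) (step (suc i))
             (subst (_~ w k) (sym eq) (~-sym (step k))) (turn i ∘ sym)
    ... | inj₁ wk≡wi =
      contradiction (sym (w-injective fresh (n<1+n k) (m<n⇒m<1+n (s<s⁻¹ j<k)) wk≡wi)) (<⇒≢ (s<s⁻¹ j<k))
    -- Here `j<k` says 2 + i ≤ 1 + k. Equality would give a loop at `w k`; otherwise freshness
    -- forces k = 2 + i, and the walk would turn back to `w (suc i)`.
    ... | inj₂ wk≡w2+i with m≤n⇒m<n∨m≡n j<k
    ...   | inj₂ refl = contradiction wk≡w2+i (w-suc≢ k)
    ...   | inj₁ 2+i<1+k with w-injective fresh (n<1+n k) 2+i<1+k wk≡w2+i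
    ...     | refl = contradiction (sym eq) (turn (suc i))

    atLeast3 : ∀ {k} → 0 < k → w 0 ≡ w k → ∃[ m ] k ≡ 3 + m
    atLeast3 {suc zero}          _ eq = contradiction eq (w-suc≢ 0)
    atLeast3 {suc (suc zero)}    _ eq = contradiction (sym eq) (turn 0)
    atLeast3 {suc (suc (suc m))} _ eq = m , refl

  private
    module _ (m : ℕ) (fresh : ∀ {i} → i < 3 + m → ¬ Repeats i) (w0≡ : w 0 ≡ w (3 + m)) where
      cyc : Fin (3 + m) → Vertex
      cyc i = w (toℕ i)

      Next : Fin (3 + m) → Fin (3 + m) → Set
      Next i j = toℕ j ≡ suc (toℕ i) % (3 + m)

      cyc-inj : Injective _≡_ _≡_ cyc
      cyc-inj eq = toℕ-injective (w-injective fresh (toℕ<n _) (toℕ<n _) eq)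

      next-w : ∀ {i j} → Next i j → w (suc (toℕ i)) ≡ cyc j
      next-w {i} {j} n with next-cases {u = i} {j} n
      ... | inj₁ (l , refl , refl) = cong (w ∘ suc) (toℕ-inject₁ l)
      ... | inj₂ (refl , refl)     = trans (cong (w ∘ suc) (toℕ-fromℕ (2 + m))) (sym w0≡)

      next~ : ∀ {i j} → Next i j → cyc i ~ cyc j
      next~ {i} {j} n = subst (cyc i ~_) (next-w {i} {j} n) (step (toℕ i))

      successor : ∀ i → ∃[ s ] Next i s
      successor i with view i
      ... | ‵fromℕ     = zero , next-top (2 + m)
      ... | ‵inject₁ j = suc j , next-inject₁ j

      -- The inequality keeps the two cycle neighbours apart, so that `HasTwo.third` excludes any
      -- further one. At vertex zero it amounts to 1 ≢ 2 + m, which needs length at least three;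
      -- elsewhere it is the ban on turning back.
      predecessor : ∀ i → ∃[ p ] Next p i × w (suc (toℕ i)) ≢ cyc p
      predecessor zero    = top (2 + m) , next-top (2 + m) , λ eq → 1≢2+m
        (w-injective fresh (s<s z<s) (n<1+n (2 + m)) (trans eq (cong w (toℕ-fromℕ (2 + m)))))
        where
        1≢2+m : 1 ≢ 2 + m
        1≢2+m ()
      predecessor (suc j) = inject₁ j , next-inject₁ j , λ eq → turn (toℕ j) (trans eq (cong w (toℕ-inject₁ j)))

      inducedCycle : InducedCycle G
      inducedCycle = record
        { m         = m
        ; cycle     = cyc
        ; injective = cyc-inj
        ; sound     = λ { {i} {j} (inj₁ n) → next~ {i} {j} n ; {i} {j} (inj₂ n) → ~-sym (next~ {j} {i} n) }
        ; closed    = closed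
        }
        where
        closed : ∀ {i v} → cyc i ~ v → ∃[ j ] v ≡ cyc j × Graph._~_ (C (3 + m)) i j
        closed {i} i~v = 
          let s , i→s = successor i
              p , p→i , s≢p = predecessor i
          in case s p i→s p→i (HasTwo.third (two (cyc i)) (next~ {i} {s} i→s) (~-sym (next~ {p} {i} p→i)) i~v
               (λ eq → s≢p (trans (next-w {i} {s} i→s) eq)))
          where
          case : ∀ s p → Next i s → Next p i → ∀ {v} → v ≡ cyc s ⊎ v ≡ cyc p →
                 ∃[ j ] v ≡ cyc j × Graph._~_ (C (3 + m)) i j
          case s p i→s p→i (inj₁ v≡) = s , v≡ , inj₁ i→s
          case s p i→s p→i (inj₂ v≡) = p , v≡ , inj₂ p→i

  theCycle : InducedCycle G
  theCycle with firstRepeat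
  ... | k , (j , eq) , fresh with closes fresh (toℕ<n j) eq
  ... | j≡0 with atLeast3 (≤-<-trans z≤n (toℕ<n j)) (subst (λ i → w i ≡ w k) j≡0 eq)
  ... | m , refl = inducedCycle m fresh (subst (λ i → w i ≡ w k) j≡0 eq)

-- Splitting off one cycle and iterating

record CycleSplitting (G : Graph) : Set₁ where
  field
    m       : ℕ
    rest    : Graph
    iso     : G ≅ C (3 + m) ⊎ᴳ rest
    simple  : Simple rest
    two     : TwoNeighbours rest

module RemoveCycle {G : Graph} (simple : Simple G) (two : TwoNeighbours G) (cyc : InducedCycle G)
  {r} (π : Permutation (3 + InducedCycle.m cyc + r) (order G))
  (π-cycle : ∀ i → π ⟨$⟩ʳ (i ↑ˡ r) ≡ InducedCycle.cycle cyc i) where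
  open Graph G using (_~_; _~?_; ~-sym; Vertex)
  open InducedCycle cyc

  private
    k : ℕ
    k = 3 + m

    left : Fin k → Vertex
    left i = π ⟨$⟩ʳ (i ↑ˡ r)

    right : Fin r → Vertex
    right u = π ⟨$⟩ʳ (k ↑ʳ u)

    rest : Graph
    rest = record
      { order = r
      ; _~_   = λ u v → right u ~ right v
      ; ~-sym = ~-sym
      ; _~?_  = λ u v → right u ~? right v
      }

    π-injective : ∀ {x y} → π ⟨$⟩ʳ x ≡ π ⟨$⟩ʳ y → x ≡ y
    π-injective eq = trans (sym (inverseˡ π)) (trans (cong (π ⟨$⟩ˡ_) eq) (inverseˡ π))

    right≢left : ∀ {u i} → right u ≢ left i
    right≢left {u} {i} eq
      with trans (sym (splitAt-↑ʳ k r u)) (trans (cong (splitAt k) (π-injective eq)) (splitAt-↑ˡ k i r))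
    ... | ()

    cross : ∀ {i u} → ¬ (left i ~ right u)
    cross {i} {u} i~u with closed (subst (_~ right u) (π-cycle i) i~u)
    ... | j , eq , _ = right≢left {u} {j} (trans eq (sym (π-cycle j)))

    πˡ : ∀ {x i} → splitAt k x ≡ inj₁ i → π ⟨$⟩ʳ x ≡ left i
    πˡ eq = cong (π ⟨$⟩ʳ_) (sym (splitAt⁻¹-↑ˡ eq))

    πʳ : ∀ {x u} → splitAt k x ≡ inj₂ u → π ⟨$⟩ʳ x ≡ right u
    πʳ eq = cong (π ⟨$⟩ʳ_) (sym (splitAt⁻¹-↑ʳ {k} eq))

    fwd′ : ∀ {x y} s t → splitAt k x ≡ s → splitAt k y ≡ t →
           Pointwise (Graph._~_ (C k)) (Graph._~_ rest) s t → π ⟨$⟩ʳ x ~ π ⟨$⟩ʳ y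
    fwd′ (inj₁ i) (inj₁ j) eqx eqy (inj₁ i~j) =
      subst₂ _~_ (sym (trans (πˡ eqx) (π-cycle i))) (sym (trans (πˡ eqy) (π-cycle j))) (sound i~j)
    fwd′ (inj₂ u) (inj₂ v) eqx eqy (inj₂ u~v) = subst₂ _~_ (sym (πʳ eqx)) (sym (πʳ eqy)) u~v

    bwd′ : ∀ {x y} s t → splitAt k x ≡ s → splitAt k y ≡ t →
           π ⟨$⟩ʳ x ~ π ⟨$⟩ʳ y → Pointwise (Graph._~_ (C k)) (Graph._~_ rest) s t
    bwd′ (inj₁ i) (inj₁ j) eqx eqy x~y
      with closed (subst₂ _~_ (trans (πˡ eqx) (π-cycle i)) (trans (πˡ eqy) (π-cycle j)) x~y)
    ... | j′ , eq , i~j′ = inj₁ (subst (Graph._~_ (C k) i) (sym (injective eq)) i~j′)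
    bwd′ (inj₁ i) (inj₂ v) eqx eqy x~y = contradiction (subst₂ _~_ (πˡ eqx) (πʳ eqy) x~y) cross
    bwd′ (inj₂ u) (inj₁ j) eqx eqy x~y = contradiction (~-sym (subst₂ _~_ (πʳ eqx) (πˡ eqy) x~y)) cross
    bwd′ (inj₂ u) (inj₂ v) eqx eqy x~y = inj₂ (subst₂ _~_ (πʳ eqx) (πʳ eqy) x~y)

    fwd : ∀ x y → Graph._~_ (C k ⊎ᴳ rest) x y → π ⟨$⟩ʳ x ~ π ⟨$⟩ʳ y
    fwd x y = fwd′ (splitAt k x) (splitAt k y) refl refl

    bwd : ∀ x y → π ⟨$⟩ʳ x ~ π ⟨$⟩ʳ y → Graph._~_ (C k ⊎ᴳ rest) x y
    bwd x y = bwd′ (splitAt k x) (splitAt k y) refl refl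

    neighbour-right : ∀ {u v} → right u ~ v → ∃[ v′ ] v ≡ right v′
    neighbour-right {u} {v} u~v with splitAt k (π ⟨$⟩ˡ v) in eq
    ... | inj₁ i  = contradiction (subst (_~ right u) (trans (sym (inverseʳ π)) (πˡ eq)) (~-sym u~v)) cross
    ... | inj₂ v′ = v′ , trans (sym (inverseʳ π)) (πʳ eq)

    right-injective : ∀ {u v} → right u ≡ right v → u ≡ v
    right-injective {u} {v} eq
      with trans (sym (splitAt-↑ʳ k r u)) (trans (cong (splitAt k) (π-injective eq)) (splitAt-↑ʳ k r v))
    ... | refl = refl

    restTwo : TwoNeighbours rest
    restTwo u with two (right u)
    ... | hasTwo a≢b u~a u~b only with neighbour-right u~a | neighbour-right u~b
    ... | a′ , refl | b′ , refl = hasTwo (a≢b ∘ cong right) u~a u~b only′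
      where
      only′ : ∀ {v} → right u ~ right v → v ≡ a′ ⊎ v ≡ b′
      only′ u~v with only u~v
      ... | inj₁ eq = inj₁ (right-injective eq)
      ... | inj₂ eq = inj₂ (right-injective eq)

  splitting : CycleSplitting G
  splitting = record
    { m      = m
    ; rest   = rest
    ; iso    = ≅-sym record { bijection = π ; preserves = λ x y → mk⇔ (fwd x y) (bwd x y) }
    ; simple = λ v → simple (right v)
    ; two    = restTwo
    }

-- Opaque to keep the explicit cycle out of the types of its clients.
opaque
  split-cycle : ∀ {G} → Simple G → TwoNeighbours G → Graph.Vertex G → CycleSplitting G
  split-cycle {G} simple two v₀ with CycleThrough.theCycle G simple two v₀
  ... | cyc with extend _ (InducedCycle.injective cyc)
  ... | r , π , π-cycle = RemoveCycle.splitting simple two cyc π π-cycle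

-- An entry `m` stands for a cycle of length 3 + m, so the lower bound on lengths is built in.
cyclesᴳ : List ℕ → Graph
cyclesᴳ []       = ∅ᴳ
cyclesᴳ (m ∷ ms) = C (3 + m) ⊎ᴳ cyclesᴳ ms

order-≅ : ∀ {F G} → F ≅ G → order F ≡ order G
order-≅ F≅G = ↔⇒≡ (_≅_.bijection F≅G)

order≡0⇒≅∅ᴳ : ∀ {G} → order G ≡ 0 → G ≅ ∅ᴳ
order≡0⇒≅∅ᴳ {G} refl = record { bijection = ↔-id _ ; preserves = λ () }

decompose : ∀ {G} → Simple G → TwoNeighbours G → ∃[ ms ] G ≅ cyclesᴳ ms
decompose = go _ _ refl ≤-refl
  where
  -- Recursion is on the bound `n`, since the remaining graph is not structurally smaller. The order
  -- is also passed as `l` so that it can be matched on.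
  go : ∀ n l {G} → order G ≡ l → l ≤ n → Simple G → TwoNeighbours G → ∃[ ms ] G ≅ cyclesᴳ ms
  go n       zero    eq l≤n simple two = [] , order≡0⇒≅∅ᴳ eq
  go (suc n) (suc l) eq l≤n simple two = m ∷ proj₁ rec , ≅-trans iso (⊎ᴳ-cong ≅-refl (proj₂ rec))
    where
    open CycleSplitting (split-cycle simple two (subst Fin (sym eq) zero))
      renaming (simple to rest-simple; two to rest-two)
    order-rest≤ : order rest ≤ n
    -- Of the 3 + m cycle vertices one pays for the decrease of the bound; the other 2 + m are
    -- discarded.
    order-rest≤ = ≤-trans (m≤n+m (order rest) (2 + m))
      (≤-trans (≤-reflexive (ℕ.suc-injective (trans (sym (order-≅ iso)) eq))) (s≤s⁻¹ l≤n))
    rec : ∃[ ms ] rest ≅ cyclesᴳ ms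
    rec = go n (order rest) refl order-rest≤ rest-simple rest-two

-- Extremal graphs

^-swap : ∀ x a b → (x ^ a) ^ b ≡ (x ^ b) ^ a
^-swap x a b = trans (^-*-assoc x a b) (trans (cong (x ^_) (*-comm a b)) (sym (^-*-assoc x b a)))

^-distribʳ-* : ∀ k x y → (x * y) ^ k ≡ x ^ k * y ^ k
^-distribʳ-* zero    x y = refl
^-distribʳ-* (suc k) x y =
  trans (cong (x * y *_) (^-distribʳ-* k x y)) ([m*n]*[o*p]≡[m*o]*[n*p] x y (x ^ k) (y ^ k))

*-tight : ∀ {a b c d} → 0 < b → 0 < d → a ≤ b → c ≤ d → a * c ≡ b * d → a ≡ b × c ≡ d
*-tight {a} {b} {c} {d} 0<b 0<d a≤b c≤d eq =
  a≡b , *-cancelˡ-≡ c d b {{>-nonZero 0<b}} (subst (λ x → x * c ≡ b * d) a≡b eq)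
  where
  a≡b : a ≡ b
  a≡b = ≤-antisym a≤b (*-cancelʳ-≤ b a d {{>-nonZero 0<d}} (≤-trans (≤-reflexive (sym eq)) (*-monoʳ-≤ a c≤d)))

pow>0 : ∀ {x} k → 0 < x → 0 < x ^ k
pow>0 {x} k 0<x = m^n>0 x {{>-nonZero 0<x}} k

copies-cycles : ∀ {ms} m → All (_≡ m) ms → ∃[ a ] cyclesᴳ ms ≡ a copiesOf C (3 + m)
copies-cycles m [] = 0 , refl
copies-cycles m (refl ∷ all) = let a , eq = copies-cycles m all in suc a , cong (C (3 + m) ⊎ᴳ_) eq

copies₃₄-cycles : ∀ {ms} → All (λ m → m ≡ 0 ⊎ m ≡ 1) ms → IsDisjointUnionOf (C 3) (C 4) (cyclesᴳ ms)
copies₃₄-cycles [] = 0 , 0 , ≅-sym (order≡0⇒≅∅ᴳ refl)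
copies₃₄-cycles (inj₁ refl ∷ all) with copies₃₄-cycles all
... | a , b , iso = suc a , b ,
  ≅-trans (⊎ᴳ-cong ≅-refl iso) (≅-sym (⊎ᴳ-assoc (C 3) (a copiesOf C 3) (b copiesOf C 4)))
copies₃₄-cycles (inj₂ refl ∷ all) with copies₃₄-cycles all
... | a , b , iso = a , suc b ,
  ≅-trans (⊎ᴳ-cong ≅-refl iso)
  -- The new four-cycle is moved past the triangles to join the other four-cycles.
  (≅-trans (≅-sym (⊎ᴳ-assoc (C 4) A B))
  (≅-trans (⊎ᴳ-cong (⊎ᴳ-comm (C 4) A) ≅-refl)
           (⊎ᴳ-assoc A (C 4) B)))
  where
  A = a copiesOf C 3
  B = b copiesOf C 4

order-copies : ∀ a F → order (a copiesOf F) ≡ a * order F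
order-copies zero    F = refl
order-copies (suc a) F = cong (order F +_) (order-copies a F)

complete⇒K-loop : ∀ H → (∀ u v → Graph._~_ H u v) → H ≅ K-loop (order H)
complete⇒K-loop H complete = record
  { bijection = ↔-id _
  ; preserves = λ v w → mk⇔ (λ _ → tt) (λ _ → complete v w)
  }

module Bound (H : Graph) where
  open WalkCounts H

  h : ℕ → ℕ
  h m = hom (C (3 + m)) H

  M : ℕ
  M = h 0 ^ 4 ⊔ h 1 ^ 3

  private
    normSq1≡ : normSq 1 ≡ h 1
    normSq1≡ = trans (sym (closedWalks-+ 1 1)) (sym (hom-C H 3))

    h₁≤M : h 1 ^ 3 ≤ M
    h₁≤M = m≤n⊔m (h 0 ^ 4) (h 1 ^ 3)

    longCycle≤ : ∀ j → h (suc j) ^ 4 ≤ h 1 ^ (4 + j)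
    longCycle≤ j = subst₂ (λ x y → x ^ 4 ≤ y ^ (4 + j)) (sym (hom-C H (3 + j))) normSq1≡ (closedWalks≤ j)

    twelfth : ∀ x → x ^ 12 ≡ (x ^ 4) ^ 3
    twelfth x = sym (^-*-assoc x 4 3)

    cube≤ : ∀ m → (h 1 ^ (3 + m)) ^ 3 ≤ M ^ (3 + m)
    cube≤ m = ≤-trans (≤-reflexive (^-swap (h 1) (3 + m) 3)) (^-monoˡ-≤ (3 + m) h₁≤M)

  Bounded Tight : Graph → Set
  Bounded F = hom F H ^ 12 ≤ M ^ order F
  Tight   F = hom F H ^ 12 ≡ M ^ order F

  cycle-bounded : ∀ m → Bounded (C (3 + m))
  cycle-bounded zero = ≤-trans (≤-reflexive (twelfth (h 0))) (^-monoˡ-≤ 3 (m≤m⊔n (h 0 ^ 4) (h 1 ^ 3)))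
  cycle-bounded (suc j) = ≤-trans (≤-reflexive (twelfth (h (suc j))))
    (≤-trans (^-monoˡ-≤ 3 (longCycle≤ j)) (cube≤ (suc j)))

  private
    hom-⊎ᴳ^12 : ∀ F G → hom (F ⊎ᴳ G) H ^ 12 ≡ hom F H ^ 12 * hom G H ^ 12
    hom-⊎ᴳ^12 F G = trans (cong (_^ 12) (hom-⊎ᴳ H F G)) (^-distribʳ-* 12 (hom F H) (hom G H))

    M-⊎ᴳ : ∀ F G → M ^ order (F ⊎ᴳ G) ≡ M ^ order F * M ^ order G
    M-⊎ᴳ F G = ^-distribˡ-+-* M (order F) (order G)

    hom-∅ᴳ^12 : hom ∅ᴳ H ^ 12 ≡ 1
    hom-∅ᴳ^12 = trans (cong (_^ 12) (hom-∅ᴳ H)) (^-zeroˡ 12)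

  bounded-≅ : ∀ {F G} → F ≅ G → Bounded G → Bounded F
  bounded-≅ F≅G = subst₂ (λ x n → x ^ 12 ≤ M ^ n) (sym (hom-≅ H F≅G)) (sym (order-≅ F≅G))

  tight-≅ : ∀ {F G} → F ≅ G → Tight G → Tight F
  tight-≅ F≅G = subst₂ (λ x n → x ^ 12 ≡ M ^ n) (sym (hom-≅ H F≅G)) (sym (order-≅ F≅G))

  bounded-⊎ᴳ : ∀ {F G} → Bounded F → Bounded G → Bounded (F ⊎ᴳ G)
  bounded-⊎ᴳ {F} {G} bF bG = subst₂ _≤_ (sym (hom-⊎ᴳ^12 F G)) (sym (M-⊎ᴳ F G)) (*-mono-≤ bF bG)

  tight-⊎ᴳ : ∀ {F G} → Tight F → Tight G → Tight (F ⊎ᴳ G)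
  tight-⊎ᴳ {F} {G} tF tG = trans (hom-⊎ᴳ^12 F G) (trans (cong₂ _*_ tF tG) (sym (M-⊎ᴳ F G)))

  tight-copies : ∀ a {F} → Tight F → Tight (a copiesOf F)
  tight-copies zero    tF = hom-∅ᴳ^12
  tight-copies (suc a) {F} tF = tight-⊎ᴳ {F} {a copiesOf F} tF (tight-copies a tF)

  bounded-cycles : ∀ ms → Bounded (cyclesᴳ ms)
  bounded-cycles []       = ≤-reflexive hom-∅ᴳ^12
  bounded-cycles (m ∷ ms) = bounded-⊎ᴳ {C (3 + m)} {cyclesᴳ ms} (cycle-bounded m) (bounded-cycles ms)

  -- A product of bounded factors that attains the product of the bounds has every factor tight,
  -- provided the bounds can be cancelled; this is what `0<M` secures.
  tight-cycles⁻ : 0 < M → ∀ ms → Tight (cyclesᴳ ms) → All (λ m → Tight (C (3 + m))) ms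
  tight-cycles⁻ 0<M []       t = []
  tight-cycles⁻ 0<M (m ∷ ms) t =
    let tC , tms = *-tight (pow>0 (3 + m) 0<M) (pow>0 (order (cyclesᴳ ms)) 0<M)
                     (cycle-bounded m) (bounded-cycles ms)
                     (trans (sym (hom-⊎ᴳ^12 (C (3 + m)) (cyclesᴳ ms)))
                       (trans t (M-⊎ᴳ (C (3 + m)) (cyclesᴳ ms))))
    in tC ∷ tight-cycles⁻ 0<M ms tms

  tight-C3 : h 1 ^ 3 ≤ h 0 ^ 4 → Tight (C 3)
  tight-C3 le = trans (twelfth (h 0)) (cong (_^ 3) (sym (m≥n⇒m⊔n≡m le)))

  tight-C4 : h 0 ^ 4 ≤ h 1 ^ 3 → Tight (C 4)
  tight-C4 le = trans (sym (^-*-assoc (h 1) 3 4)) (cong (_^ 4) (sym (m≤n⇒m⊔n≡n le)))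

  ¬tight-C3 : h 0 ^ 4 < h 1 ^ 3 → ¬ Tight (C 3)
  ¬tight-C3 lt t = <⇒≢ (^-monoˡ-< 3 (<-≤-trans lt h₁≤M)) (trans (sym (twelfth (h 0))) t)

  ¬tight-C4 : h 1 ^ 3 < h 0 ^ 4 → ¬ Tight (C 4)
  ¬tight-C4 lt t =
    <⇒≢ (^-monoˡ-< 4 (<-≤-trans lt (m≤m⊔n (h 0 ^ 4) (h 1 ^ 3)))) (trans (^-*-assoc (h 1) 3 4) t)

  module _ (noIso : NoIsolatedVertices H) (order≢0 : NonZero (order H))
           (incomplete : ¬ (∀ u v → Graph._~_ H u v)) where

    0<normSq1 : 0 < normSq 1
    0<normSq1 = normSq1>0 noIso (vertex order≢0)
      where
      vertex : ∀ {n} → NonZero n → Fin n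
      vertex {suc n} _ = zero

    0<M : 0 < M
    0<M = ≤-trans (pow>0 3 (subst (0 <_) normSq1≡ 0<normSq1)) h₁≤M

    ¬tight-long : ∀ j → ¬ Tight (C (5 + j))
    ¬tight-long j t =
      <⇒≢ (<-≤-trans (^-monoˡ-< 3 strict) (cube≤ (2 + j))) (trans (sym (twelfth (h (2 + j)))) t)
      where
      strict : h (2 + j) ^ 4 < h 1 ^ (5 + j)
      strict = subst₂ (λ x y → x ^ 4 < y ^ (5 + j)) (sym (hom-C H (4 + j))) normSq1≡
        (closedWalks< 0<normSq1 (incomplete⇒gap noIso incomplete) j)

    tight⇒short : ∀ {m} → Tight (C (3 + m)) → m ≡ 0 ⊎ m ≡ 1
    tight⇒short {zero}        t = inj₁ refl
    tight⇒short {suc zero}    t = inj₂ refl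
    tight⇒short {suc (suc j)} t = contradiction t (¬tight-long j)

    tight⇒allShort : ∀ ms → Tight (cyclesᴳ ms) → All (λ m → Tight (C (3 + m)) × (m ≡ 0 ⊎ m ≡ 1)) ms
    tight⇒allShort ms t = All.map (λ t → t , tight⇒short t) (tight-cycles⁻ 0<M ms t)

    module _ {G : Graph} {ms : List ℕ} (G≅ : G ≅ cyclesᴳ ms) where

      private
        all-≡⇒copies : ∀ {m} → All (_≡ m) ms → IsCopiesOf (C (3 + m)) G
        all-≡⇒copies {m} all with copies-cycles m all
        ... | a , eq = divides a (trans (order-≅ G≅a) (order-copies a (C (3 + m)))) , G≅a
          where
          G≅a : G ≅ a copiesOf C (3 + m)
          G≅a = subst (G ≅_) eq G≅

        tight⇒ : Tight G → All (λ m → Tight (C (3 + m)) × (m ≡ 0 ⊎ m ≡ 1)) ms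
        tight⇒ t = tight⇒allShort ms (tight-≅ (≅-sym G≅) t)

      copies⇒tight : ∀ {F} → Tight F → IsCopiesOf F G → Tight G
      copies⇒tight {F} tF (k∣n , iso) =
        tight-≅ {G} {quotientℕ k∣n copiesOf F} iso (tight-copies (quotientℕ k∣n) {F} tF)

      tight⇔C3 : h 1 ^ 3 < h 0 ^ 4 → Tight G ⇔ IsCopiesOf (C 3) G
      tight⇔C3 lt = mk⇔ (λ t → all-≡⇒copies (All.map is0 (tight⇒ t)))
                        (copies⇒tight {C 3} (tight-C3 (<⇒≤ lt)))
        where
        is0 : ∀ {m} → Tight (C (3 + m)) × (m ≡ 0 ⊎ m ≡ 1) → m ≡ 0
        is0 (t , inj₁ m≡0)  = m≡0
        is0 (t , inj₂ refl) = contradiction t (¬tight-C4 lt)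

      tight⇔C4 : h 0 ^ 4 < h 1 ^ 3 → Tight G ⇔ IsCopiesOf (C 4) G
      tight⇔C4 lt = mk⇔ (λ t → all-≡⇒copies (All.map is1 (tight⇒ t)))
                        (copies⇒tight {C 4} (tight-C4 (<⇒≤ lt)))
        where
        is1 : ∀ {m} → Tight (C (3 + m)) × (m ≡ 0 ⊎ m ≡ 1) → m ≡ 1
        is1 (t , inj₁ refl) = contradiction t (¬tight-C3 lt)
        is1 (t , inj₂ m≡1)  = m≡1

      tight⇔C3⊎C4 : h 0 ^ 4 ≡ h 1 ^ 3 → Tight G ⇔ IsDisjointUnionOf (C 3) (C 4) G
      tight⇔C3⊎C4 eq = mk⇔ fwd bwd
        where
        fwd : Tight G → IsDisjointUnionOf (C 3) (C 4) G
        fwd t = let a , b , iso = copies₃₄-cycles (All.map proj₂ (tight⇒ t)) in a , b , ≅-trans G≅ iso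
        bwd : IsDisjointUnionOf (C 3) (C 4) G → Tight G
        bwd (a , b , iso) = tight-≅ {G} {a copiesOf C 3 ⊎ᴳ b copiesOf C 4} iso
          (tight-⊎ᴳ {a copiesOf C 3} {b copiesOf C 4}
            (tight-copies a {C 3} (tight-C3 (≤-reflexive (sym eq))))
            (tight-copies b {C 4} (tight-C4 (≤-reflexive eq))))

-- Translation to fractional powers

module _ (x a b n : ℕ) where

  private
    bound : Power
    bound = max (a ^⟨ n / 3 ⟩) (b ^⟨ n / 4 ⟩)

    -- The left side is what comparing `x` with the maximum unfolds to, opposite `x ^ 12`. Taking
    -- `n`-th powers is monotone, so it commutes with the maximum.
    bound≡ : (a ^ (n * 4) ⊔ b ^ (n * 3)) ^ 1 ≡ (a ^ 4 ⊔ b ^ 3) ^ n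
    bound≡ = begin
      (a ^ (n * 4) ⊔ b ^ (n * 3)) ^ 1    ≡⟨ ^-identityʳ _ ⟩
      a ^ (n * 4) ⊔ b ^ (n * 3)          ≡⟨ cong₂ _⊔_ (expo a 4) (expo b 3) ⟩
      (a ^ 4) ^ n ⊔ (b ^ 3) ^ n          ≡⟨ mono-≤-distrib-⊔ (^-monoˡ-≤ n) (a ^ 4) (b ^ 3) ⟨
      (a ^ 4 ⊔ b ^ 3) ^ n                ∎
      where
      open ≡-Reasoning
      expo : ∀ x k → x ^ (n * k) ≡ (x ^ k) ^ n
      expo x k = trans (cong (x ^_) (*-comm n k)) (sym (^-*-assoc x k n))

  ≤ᵖ-bound : x ^ 12 ≤ (a ^ 4 ⊔ b ^ 3) ^ n → fromℕ x ≤ᵖ bound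
  ≤ᵖ-bound = subst (x ^ 12 ≤_) (sym bound≡)

  ≈ᵖ-bound : ∀ {P : Set} → (x ^ 12 ≡ (a ^ 4 ⊔ b ^ 3) ^ n) ⇔ P → fromℕ x ≈ᵖ bound ⇔ P
  ≈ᵖ-bound {P} = subst (λ y → (x ^ 12 ≡ y) ⇔ P) (sym bound≡)

theorem1p1 : (H : Graph) → NoIsolatedVertices H →
    (G : Graph) → Simple G → Regular 2 G →
    let n     = Graph.order G
        hG    = fromℕ (hom G H)
        h₃    = hom (C 3) H
        h₄    = hom (C 4) H
        bound = max (h₃ ^⟨ n / 3 ⟩) (h₄ ^⟨ n / 4 ⟩)
    in
    hG ≤ᵖ bound
    × (NonZero (Graph.order H) →
       (∀ q → 1 ≤ q → ¬ (H ≅ K-loop q)) →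
       (h₄ ^⟨ 1 / 4 ⟩ <ᵖ h₃ ^⟨ 1 / 3 ⟩ →
          hG ≈ᵖ bound ⇔ IsCopiesOf (C 3) G)
       × (h₃ ^⟨ 1 / 3 ⟩ <ᵖ h₄ ^⟨ 1 / 4 ⟩ →
          hG ≈ᵖ bound ⇔ IsCopiesOf (C 4) G)
       × (h₃ ^⟨ 1 / 3 ⟩ ≈ᵖ h₄ ^⟨ 1 / 4 ⟩ →
          hG ≈ᵖ bound ⇔ IsDisjointUnionOf (C 3) (C 4) G))
theorem1p1 H noIso G simple regular =
  ≤ᵖ-bound g (h 0) (h 1) n (bounded-≅ G≅ (bounded-cycles ms)) ,
  λ order≢0 notK →
    let incomplete = λ complete →
          notK (order H) (>-nonZero⁻¹ _ {{order≢0}}) (complete⇒K-loop H complete)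
    in (λ lt → ≈ᵖ-bound g (h 0) (h 1) n (tight⇔C3 noIso order≢0 incomplete {ms = ms} G≅ lt))
     , (λ lt → ≈ᵖ-bound g (h 0) (h 1) n (tight⇔C4 noIso order≢0 incomplete {ms = ms} G≅ lt))
     , (λ eq → ≈ᵖ-bound g (h 0) (h 1) n (tight⇔C3⊎C4 noIso order≢0 incomplete {ms = ms} G≅ eq))
  where
  open Bound H
  n = order G
  g = hom G H
  decomposition = decompose simple (regular⇒twoNeighbours {G} regular)
  ms = proj₁ decomposition
  G≅ = proj₂ decomposition
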